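{- Let $n>1$ and let $NC(10n+5,5)$ be the number of non-isomorphic cyclic $(K_{10n+5},C_5)$-designs. Then there is an integer $N$ such that for all $n\ge N$: - if $n\equiv 3,5,24,26\pmod{28}$, then $NC(10n+5,5)\ge (38.4)^n$; - if $n\not\equiv 3,5,24,26\pmod{28}$, then $NC(10n+5,5)\ge (29.7)^n$.
   Context: A $(K_v,C_k)$-design (or $k$-cycle system of the complete graph $K_v$) is a set $\mathcal{B}$ of $k$-cycles of $K_v$ whose edges partition the edge-set of $K_v$. It is cyclic if the vertex-set can be identified with $\mathbb{Z}_v$ in such a way that $B=(b_1,\dots,b_k)\in\mathcal{B}$ implies $B+z=(b_1+z,\dots,b_k+z)\in\mathcal{B}$ for all $z\in\mathbb{Z}_v$. Two $(K_v,C_k)$-designs with cycle sets $\mathcal{B}$ and $\mathcal{B}'$ are isomorphic if there is a permutation of the vertex-set turning $\mathcal{B}$ into $\mathcal{B}'$. $NC(v,k)$ is the number of cyclic $(K_v,C_k)$-designs up to isomorphism. -}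

module Defs where

open import Data.Fin.Base using (Fin; toℕ)
open import Data.Fin.Permutation
  using (Permutation′; permutation; _⟨$⟩ʳ_; _⟨$⟩ˡ_; inverseˡ; inverseʳ; flip; _∘ₚ_)
  renaming (id to idₚ)
import Data.Fin.Properties as Fin
open import Data.List.Base as List
  using (List; []; _∷_; _++_; length; filter; deduplicate; allFin; cartesianProductWith)
import Data.List.Membership.DecSetoid as DecMembership
open import Data.List.Membership.Propositional using () renaming (_∈_ to _∈ˡ_)
open import Data.List.Membership.Propositional.Properties
  using (∈-allFin; ∈-cartesianProductWith⁺; ∈-filter⁺; ∈-map⁺; ∈-++⁺ˡ; ∈-++⁺ʳ)
import Data.List.Membership.Setoid.Properties as Membership
import Data.List.Properties as List
import Data.List.Relation.Binary.Subset.Setoid as Subset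
open import Data.List.Relation.Unary.All as All using (All)
import Data.List.Relation.Unary.All.Properties as All
open import Data.List.Relation.Unary.AllPairs using (AllPairs)
open import Data.List.Relation.Unary.Any as Any using (Any; here)
import Data.List.Relation.Unary.Any.Properties as Any
open import Data.List.Relation.Unary.Unique.DecSetoid.Properties using (deduplicate-!)
open import Data.Nat.Base using (ℕ; suc; _+_; _≤_)
open import Data.Nat.DivMod using (_mod_)
open import Data.Nat.Properties using (_≤?_)
open import Data.Product as Product using (_×_; _,_; proj₁; proj₂; ∃; ∃-syntax; ∃!)
open import Data.Product.Properties using (≡-dec)
open import Data.Sum.Base as Sum using (_⊎_; inj₁; inj₂)
open import Data.Vec.Base as Vec using (Vec; []; _∷_; _∷ʳ_; zip)
open import Data.Vec.Membership.Propositional using () renaming (_∈_ to _∈ᵛ_; find to findᵛ)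
import Data.Vec.Membership.DecPropositional as DecVecMembership
open import Data.Vec.Membership.Propositional.Properties using () renaming (∈-map⁺ to ∈ᵛ-map⁺)
import Data.Vec.Properties as Vec
import Data.Vec.Relation.Unary.Any.Properties as VecAny
open import Data.Vec.Relation.Unary.AllPairs using (allPairs?)
open import Data.Vec.Relation.Unary.Unique.Propositional using (Unique)
open import Function.Base using (_∘_; _$_; id)
open import Function.Bundles using (_⇔_; mk⇔; Equivalence)
open import Level using (0ℓ)
open import Relation.Binary.Bundles using (DecSetoid; Setoid)
open import Relation.Binary.PropositionalEquality
  using (_≡_; _≢_; _≗_; refl; sym; trans; cong; subst; subst₂)
open import Relation.Nullary using (¬_; Dec; yes; no; ¬?; _×-dec_; _⊎-dec_; _→-dec_)
open import Relation.Nullary.Decidable using (map′)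
open import Relation.Unary using (Decidable)

open Equivalence using (to; from)

-- The cycle (b₁ , … , bₖ) has edges b₁b₂ , … , bₖ₋₁bₖ , bₖb₁.

edges : ∀ {A : Set} {k} → Vec A k → Vec (A × A) k
edges []       = []
edges (b ∷ bs) = zip (b ∷ bs) (bs ∷ʳ b)

Joins : ∀ {v k} → Vec (Fin v) k → Fin v → Fin v → Set
Joins c x y = ((x , y) ∈ᵛ edges c) ⊎ ((y , x) ∈ᵛ edges c)

IsCycle : ∀ {v k} → Vec (Fin v) k → Set
IsCycle {k = k} c = 3 ≤ k × Unique c

-- Cycles are subgraphs: rotating or reversing the vertex sequence does
-- not change the cycle.

record SameCycle {v k} (c d : Vec (Fin v) k) : Set where
  constructor same
  field joins⇔ : ∀ x y → Joins c x y ⇔ Joins d x y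

open SameCycle public

joins? : ∀ {v k} (c : Vec (Fin v) k) x y → Dec (Joins c x y)
joins? c x y = ((x , y) ∈? edges c) ⊎-dec ((y , x) ∈? edges c)
  where open DecVecMembership (≡-dec Fin._≟_ Fin._≟_) using (_∈?_)

isCycle? : ∀ {v k} → Decidable (IsCycle {v} {k})
isCycle? {k = k} c = (3 ≤? k) ×-dec allPairs? (λ x y → ¬? (x Fin.≟ y)) c

sameCycle? : ∀ {v k} (c d : Vec (Fin v) k) → Dec (SameCycle c d)
sameCycle? c d = map′ same joins⇔ (Fin.all? λ x → Fin.all? λ y →
  map′ (λ (f , g) → mk⇔ f g) (λ e → to e , from e)
    ((joins? c x y →-dec joins? d x y) ×-dec (joins? d x y →-dec joins? c x y)))

cycleDecSetoid : ℕ → ℕ → DecSetoid 0ℓ 0ℓ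
cycleDecSetoid v k = record
  { Carrier = Vec (Fin v) k
  ; _≈_ = SameCycle
  ; isDecEquivalence = record
    { isEquivalence = record
      { refl  = same λ x y → mk⇔ id id
      ; sym   = λ (same p) → same λ x y → mk⇔ (from (p x y)) (to (p x y))
      ; trans = λ (same p) (same q) → same λ x y →
                  mk⇔ (to (q x y) ∘ to (p x y)) (from (p x y) ∘ from (q x y))
      }
    ; _≟_ = sameCycle?
    }
  }

cycleSetoid : ℕ → ℕ → Setoid 0ℓ 0ℓ
cycleSetoid v k = DecSetoid.setoid (cycleDecSetoid v k)

-- A list of vertex sequences stands for the set of cycles they
-- describe; order, repetitions and the choice of vertex sequence for
-- each cycle are immaterial, and c ∈ B is membership up to SameCycle.

Blocks : ℕ → ℕ → Set
Blocks v k = List (Vec (Fin v) k)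

module _ {v k : ℕ} where

  open DecMembership (cycleDecSetoid v k) public using (_∈_; _∈?_; find)
  open Subset (cycleSetoid v k) public using (_⊆_)

  infix 4 _≐_

  _≐_ : Blocks v k → Blocks v k → Set
  B ≐ B′ = B ⊆ B′ × B′ ⊆ B

image : ∀ {v w k} → (Fin v → Fin w) → Blocks v k → Blocks w k
image f = List.map (Vec.map f)

IsDesign : ∀ {v k} → Blocks v k → Set
IsDesign B = All IsCycle B × (∀ x y → x ≢ y → ∃! SameCycle λ c → c ∈ B × Joins c x y)

infixl 6 _⊕_

_⊕_ : ∀ {v} → Fin v → Fin v → Fin v
_⊕_ {v} x z = (toℕ x + toℕ z) mod v
  where instance _ = Fin.nonZeroIndex x

-- x ↦ x + z, for the identification φ of the vertices with ℤ/v.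

translate : ∀ {v} → Permutation′ v → Fin v → Fin v → Fin v
translate φ z x = φ ⟨$⟩ˡ ((φ ⟨$⟩ʳ x) ⊕ z)

IsCyclic : ∀ {v k} → Blocks v k → Set
IsCyclic {v} B = ∃[ φ ] ∀ (z : Fin v) → image (translate φ z) B ⊆ B

IsCyclicDesign : ∀ {v k} → Blocks v k → Set
IsCyclicDesign B = IsDesign B × IsCyclic B

record Isomorphic {v k} (B B′ : Blocks v k) : Set where
  constructor iso
  field
    π      : Permutation′ v
    image≐ : image (π ⟨$⟩ʳ_) B ≐ B′

vectors : ∀ v k → List (Vec (Fin v) k)
vectors v 0       = [] ∷ []
vectors v (suc k) = cartesianProductWith _∷_ (allFin v) (vectors v k)

∈-vectors : ∀ {v k} (c : Vec (Fin v) k) → c ∈ˡ vectors v k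
∈-vectors []      = here refl
∈-vectors (x ∷ c) = ∈-cartesianProductWith⁺ _∷_ (∈-allFin x) (∈-vectors c)

sublists : ∀ {A : Set} → List A → List (List A)
sublists []       = [] ∷ []
sublists (x ∷ xs) = List.map (x ∷_) (sublists xs) ++ sublists xs

filter-∈-sublists : ∀ {A : Set} {P : A → Set} (P? : Decidable P) xs →
                    filter P? xs ∈ˡ sublists xs
filter-∈-sublists P? []       = here refl
filter-∈-sublists P? (x ∷ xs) with P? x
... | yes _ = ∈-++⁺ˡ (∈-map⁺ (x ∷_) (filter-∈-sublists P? xs))
... | no  _ = ∈-++⁺ʳ (List.map (x ∷_) (sublists xs)) (filter-∈-sublists P? xs)

∃permutation? : ∀ {v} (P : (f g : Fin v → Fin v) → Set) →
                (∀ {f f′ g g′} → f ≗ f′ → g ≗ g′ → P f g → P f′ g′) →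
                (∀ f g → Dec (P f g)) →
                Dec (∃[ π ] P (π ⟨$⟩ʳ_) (π ⟨$⟩ˡ_))
∃permutation? {v} P resp P? = map′ there back
  (Any.any? (λ f → Any.any? (Q? f) (vectors v v)) (vectors v v))
  where
  Q : (f g : Vec (Fin v) v) → Set
  Q f g = (∀ x → Vec.lookup f (Vec.lookup g x) ≡ x) ×
          (∀ x → Vec.lookup g (Vec.lookup f x) ≡ x) ×
          P (Vec.lookup f) (Vec.lookup g)

  Q? : ∀ f g → Dec (Q f g)
  Q? f g = Fin.all? (λ _ → _ Fin.≟ _) ×-dec Fin.all? (λ _ → _ Fin.≟ _) ×-dec P? _ _

  there : Any (λ f → Any (Q f) (vectors v v)) (vectors v v) →
          ∃[ π ] P (π ⟨$⟩ʳ_) (π ⟨$⟩ˡ_)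
  there p with f , q ← Any.satisfied p with g , fg , gf , r ← Any.satisfied q =
    permutation (Vec.lookup f) (Vec.lookup g) fg gf , r

  back : ∃[ π ] P (π ⟨$⟩ʳ_) (π ⟨$⟩ˡ_) →
         Any (λ f → Any (Q f) (vectors v v)) (vectors v v)
  back (π , p) = Any.map (λ { refl → Any.map (λ { refl → q }) (∈-vectors g) }) (∈-vectors f)
    where
    f g : Vec (Fin v) v
    f = Vec.tabulate (π ⟨$⟩ʳ_)
    g = Vec.tabulate (π ⟨$⟩ˡ_)

    f≗ : (π ⟨$⟩ʳ_) ≗ Vec.lookup f
    f≗ x = sym (Vec.lookup∘tabulate _ x)

    g≗ : (π ⟨$⟩ˡ_) ≗ Vec.lookup g
    g≗ x = sym (Vec.lookup∘tabulate _ x)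

    q : Q f g
    q = (λ x → trans (sym (f≗ _)) (trans (cong (π ⟨$⟩ʳ_) (sym (g≗ x))) (inverseʳ π)))
      , (λ x → trans (sym (g≗ _)) (trans (cong (π ⟨$⟩ˡ_) (sym (f≗ x))) (inverseˡ π)))
      , resp f≗ g≗ p

image-cong : ∀ {v w k} {f g : Fin v → Fin w} → f ≗ g → image {k = k} f ≗ image g
image-cong f≗g = List.map-cong (Vec.map-cong f≗g)

module _ {v k : ℕ} where

  open DecSetoid (cycleDecSetoid v k) public using ()
    renaming (refl to ≈-refl; sym to ≈-sym; trans to ≈-trans)

  infix 4 _⊆?_ _≐?_

  ∈-resp-≈ : ∀ {B : Blocks v k} {c d} → SameCycle c d → c ∈ B → d ∈ B
  ∈-resp-≈ = Membership.∈-resp-≈ (cycleSetoid v k)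

  _⊆?_ : (B B′ : Blocks v k) → Dec (B ⊆ B′)
  B ⊆? B′ = map′
    (λ p c∈B → All.lookupₛ (cycleSetoid v k) ∈-resp-≈ p c∈B)
    (λ B⊆B′ → All.tabulateₛ (cycleSetoid v k) B⊆B′)
    (All.all? (_∈? B′) B)

  _≐?_ : (B B′ : Blocks v k) → Dec (B ≐ B′)
  B ≐? B′ = (B ⊆? B′) ×-dec (B′ ⊆? B)

  isDesign? : (B : Blocks v k) → Dec (IsDesign B)
  isDesign? B = All.all? isCycle? B ×-dec
    Fin.all? λ x → Fin.all? λ y → ¬? (x Fin.≟ y) →-dec unique? x y
    where
    module _ (x y : Fin v) where

      Q : Vec (Fin v) k → Set
      Q c = Joins c x y × All (λ d → Joins d x y → SameCycle c d) B

      there : Any Q B → ∃! SameCycle λ c → c ∈ B × Joins c x y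
      there p with c , c∈B , cxy , u ← find p =
        c , (c∈B , cxy) ,
        λ (d∈B , dxy) → All.lookupₛ (cycleSetoid v k)
          (λ d≈e h exy → ≈-trans (h (from (joins⇔ d≈e x y) exy)) d≈e) u d∈B dxy

      back : (∃! SameCycle λ c → c ∈ B × Joins c x y) → Any Q B
      back (c , (c∈B , cxy) , u) = Any.map
        (λ c≈d → to (joins⇔ c≈d x y) cxy ,
                 All.tabulateₛ (cycleSetoid v k)
                   (λ e∈B exy → ≈-trans (≈-sym c≈d) (u (e∈B , exy))))
        c∈B

      unique? : Dec (∃! SameCycle λ c → c ∈ B × Joins c x y)
      unique? = map′ there back
        (Any.any? (λ c → joins? c x y ×-dec
                         All.all? (λ d → joins? d x y →-dec sameCycle? c d) B) B)

  isCyclic? : (B : Blocks v k) → Dec (IsCyclic B)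
  isCyclic? B = ∃permutation?
    (λ f g → ∀ z → image (λ x → g (f x ⊕ z)) B ⊆ B)
    (λ {f} {_} {_} {g′} f≗ g≗ p z → subst (_⊆ B)
      (image-cong (λ x → trans (g≗ (f x ⊕ z)) (cong (λ w → g′ (w ⊕ z)) (f≗ x))) B) (p z))
    (λ f g → Fin.all? λ z → image _ B ⊆? B)

  isCyclicDesign? : (B : Blocks v k) → Dec (IsCyclicDesign B)
  isCyclicDesign? B = isDesign? B ×-dec isCyclic? B

  isomorphic? : (B B′ : Blocks v k) → Dec (Isomorphic B B′)
  isomorphic? B B′ = map′ (λ (π , p) → iso π p) (λ (iso π p) → π , p) (∃permutation?
    (λ f _ → image f B ≐ B′)
    (λ f≗ _ → subst (_≐ B′) (image-cong f≗ B))
    (λ f _ → image f B ≐? B′))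

-- Every set of k-cycles is described by some sublist of vectors v k, so
-- representatives v k meets each isomorphism class of cyclic designs
-- exactly once: see representatives-distinct and representatives-complete.

representatives : ∀ v k → List (Blocks v k)
representatives v k = deduplicate isomorphic? (filter isCyclicDesign? (sublists (vectors v k)))

NC : ℕ → ℕ → ℕ
NC v k = length (representatives v k)

representatives-cyclic : ∀ v k → All IsCyclicDesign (representatives v k)
representatives-cyclic v k =
  All.deduplicate⁺ isomorphic? (All.all-filter isCyclicDesign? (sublists (vectors v k)))

edges-map : ∀ {A B : Set} {k} (f : A → B) (c : Vec A k) →
            edges (Vec.map f c) ≡ Vec.map (Product.map f f) (edges c)
edges-map f []       = refl
edges-map f (b ∷ bs) = trans (cong (zip (f b ∷ Vec.map f bs)) (sym (Vec.map-∷ʳ f b bs)))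
                             (sym (map-zip (b ∷ bs) (bs ∷ʳ b)))
  where
  map-zip : ∀ {n} (xs ys : Vec _ n) →
            Vec.map (Product.map f f) (zip xs ys) ≡ zip (Vec.map f xs) (Vec.map f ys)
  map-zip []       []       = refl
  map-zip (x ∷ xs) (y ∷ ys) = cong (_ ∷_) (map-zip xs ys)

module _ {v w k : ℕ} (f : Fin v → Fin w) where

  Joins-map⁺ : ∀ (c : Vec (Fin v) k) {x y} → Joins c x y → Joins (Vec.map f c) (f x) (f y)
  Joins-map⁺ c {x} {y} = Sum.map (lift (x , y)) (lift (y , x))
    where
    lift : ∀ p → p ∈ᵛ edges c → Product.map f f p ∈ᵛ edges (Vec.map f c)
    lift p p∈ = subst (_ ∈ᵛ_) (sym (edges-map f c)) (∈ᵛ-map⁺ (Product.map f f) p∈)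

  Joins-map⁻ : ∀ (c : Vec (Fin v) k) {x y} → Joins (Vec.map f c) x y →
               ∃[ a ] ∃[ b ] f a ≡ x × f b ≡ y × Joins c a b
  Joins-map⁻ c = λ
    { (inj₁ p) → let a , b , fa , fb , q = lower p in a , b , fa , fb , inj₁ q
    ; (inj₂ p) → let a , b , fa , fb , q = lower p in b , a , fb , fa , inj₂ q
    }
    where
    lower : ∀ {x y} → (x , y) ∈ᵛ edges (Vec.map f c) →
            ∃[ a ] ∃[ b ] f a ≡ x × f b ≡ y × (a , b) ∈ᵛ edges c
    lower p with (a , b) , q , refl ← findᵛ
                   (VecAny.map⁻ (subst (_ ∈ᵛ_) (edges-map f c) p)) = a , b , refl , refl , q

  map-resp-≈ : ∀ {c d : Vec (Fin v) k} → SameCycle c d → SameCycle (Vec.map f c) (Vec.map f d)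
  map-resp-≈ {c} {d} (same c≈d) = same λ x y → mk⇔
    (λ j → let a , b , fa , fb , q = Joins-map⁻ c j in
           subst₂ (Joins (Vec.map f d)) fa fb (Joins-map⁺ d (to (c≈d a b) q)))
    (λ j → let a , b , fa , fb , q = Joins-map⁻ d j in
           subst₂ (Joins (Vec.map f c)) fa fb (Joins-map⁺ c (from (c≈d a b) q)))

  image-mono : ∀ {B B′ : Blocks v k} → B ⊆ B′ → image f B ⊆ image f B′
  image-mono B⊆B′ p
    with c , c∈B , r ← Membership.∈-map⁻ (cycleSetoid v k) (cycleSetoid w k) p
    = ∈-resp-≈ (≈-sym r)
        (Membership.∈-map⁺ (cycleSetoid v k) (cycleSetoid w k) map-resp-≈ (B⊆B′ c∈B))

image-id : ∀ {v k} {f : Fin v → Fin v} → f ≗ id → (B : Blocks v k) → image f B ≡ B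
image-id f≗id B = trans (List.map-cong (λ c → trans (Vec.map-cong f≗id c) (Vec.map-id c)) B)
                        (List.map-id B)

image-∘ : ∀ {u v w k} (g : Fin v → Fin w) (f : Fin u → Fin v) (B : Blocks u k) →
          image (g ∘ f) B ≡ image g (image f B)
image-∘ g f B = trans (List.map-cong (Vec.map-∘ g f) B) (List.map-∘ B)

module _ {v k : ℕ} where

  Isomorphic-sym : ∀ {B B′ : Blocks v k} → Isomorphic B B′ → Isomorphic B′ B
  Isomorphic-sym {B} {B′} (iso π (p , q)) = iso (flip π) $
    (λ x → subst (_ ∈_) undo (image-mono (π ⟨$⟩ˡ_) q x)) ,
    (λ x → image-mono (π ⟨$⟩ˡ_) p (subst (_ ∈_) (sym undo) x))
    where
    undo : image (π ⟨$⟩ˡ_) (image (π ⟨$⟩ʳ_) B) ≡ B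
    undo = trans (sym (image-∘ (π ⟨$⟩ˡ_) (π ⟨$⟩ʳ_) B)) (image-id (λ _ → inverseˡ π) B)

  Isomorphic-trans : ∀ {B B′ B″ : Blocks v k} →
                     Isomorphic B B′ → Isomorphic B′ B″ → Isomorphic B B″
  Isomorphic-trans {B} (iso π (p , q)) (iso ρ (r , s)) = iso (π ∘ₚ ρ) $
    (λ x → r (image-mono (ρ ⟨$⟩ʳ_) p (subst (_ ∈_) split x))) ,
    (λ x → subst (_ ∈_) (sym split) (image-mono (ρ ⟨$⟩ʳ_) q (s x)))
    where
    split = image-∘ (ρ ⟨$⟩ʳ_) (π ⟨$⟩ʳ_) B

  ≐⇒Isomorphic : ∀ {B B′ : Blocks v k} → B ≐ B′ → Isomorphic B B′
  ≐⇒Isomorphic {B} p = iso idₚ $ subst (_≐ _) (sym (image-id (λ _ → refl) B)) p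

isomorphicDecSetoid : ℕ → ℕ → DecSetoid 0ℓ 0ℓ
isomorphicDecSetoid v k = record
  { Carrier = Blocks v k
  ; _≈_ = Isomorphic
  ; isDecEquivalence = record
    { isEquivalence = record
      { refl  = ≐⇒Isomorphic (id , id)
      ; sym   = Isomorphic-sym
      ; trans = Isomorphic-trans
      }
    ; _≟_ = isomorphic?
    }
  }

representatives-distinct : ∀ v k → AllPairs (λ B B′ → ¬ Isomorphic B B′) (representatives v k)
representatives-distinct v k = deduplicate-! (isomorphicDecSetoid v k)
  (filter isCyclicDesign? (sublists (vectors v k)))

IsCyclicDesign-resp-≐ : ∀ {v k} {B B′ : Blocks v k} → B ≐ B′ → All IsCycle B′ →
                        IsCyclicDesign B → IsCyclicDesign B′
IsCyclicDesign-resp-≐ {v} {k} (B⊆B′ , B′⊆B) cycles ((_ , part) , φ , cyc) =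
  (cycles , λ x y x≢y → let c , (c∈B , cxy) , u = part x y x≢y in
    c , (B⊆B′ c∈B , cxy) , λ (d∈B′ , dxy) → u (B′⊆B d∈B′ , dxy)) ,
  φ , λ z x → B⊆B′ (cyc z (image-mono (translate φ z) B′⊆B x))

representatives-complete : ∀ {v k} {B : Blocks v k} → IsCyclicDesign B →
                           Any (Isomorphic B) (representatives v k)
representatives-complete {v} {k} {B} design = Any.deduplicate⁺ isomorphic?
  (λ C′≅C B≅C → Isomorphic-trans B≅C (Isomorphic-sym C′≅C))
  (Any.map (λ { refl → ≐⇒Isomorphic B≐B′ })
    (∈-filter⁺ isCyclicDesign? (filter-∈-sublists keep? (vectors v k))
      (IsCyclicDesign-resp-≐ B≐B′ (All.map proj₁ kept) design)))
  where
  keep? : Decidable λ c → IsCycle c × c ∈ B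
  keep? c = isCycle? c ×-dec c ∈? B

  B′ : Blocks v k
  B′ = filter keep? (vectors v k)

  kept : All (λ c → IsCycle c × c ∈ B) B′
  kept = All.all-filter keep? (vectors v k)

  cycle-in : ∀ {c} → c ∈ˡ B → c ∈ B′
  cycle-in c∈B = Any.map (λ { refl → ≈-refl })
    (∈-filter⁺ keep? (∈-vectors _)
      (All.lookup (proj₁ (proj₁ design)) c∈B , Any.map (λ { refl → ≈-refl }) c∈B))

  B≐B′ : B ≐ B′
  B≐B′ = All.lookupₛ (cycleSetoid v k) ∈-resp-≈ (All.tabulate cycle-in)
       , All.lookupₛ (cycleSetoid v k) ∈-resp-≈ (All.map proj₂ kept)

{-# OPTIONS --safe #-}

-- With h = 2n + 1 and v = 10n + 5 = 5h, let a permutation pair every x in 1 … n with some w in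
-- n + 1 … 2n, and put y = h + x.  The cycles (0, x, y + w, y, 2y) have edge differences
-- x, h + w, w, y and 2y, which up to sign exhaust the residues off the multiples of h, whatever
-- the permutation is; the remaining differences ± h and ± 2h come from two orbits of length h.
-- So each of the n! permutations gives a cyclic design.  An isomorphism from such a design to a
-- given one is determined by its values on the cosets of h at 0 and 1: two consecutive points
-- r and r + 1 determine the image of the translate of (0, 1, …, 2h + 2) through them, hence that
-- of r + 2h + 2, which lies in the coset of r + 2.  An isomorphism class therefore contains at
-- most v¹⁰ of these designs, and n! ≤ NC(v, 5) v¹⁰ outgrows 39ⁿ v¹⁰.

module Submission where

open import Data.Nat using (ℕ; _+_; _*_; _>_; _≥_; _%_)
open import Data.Integer using (+_)
open import Data.List using ([]; _∷_)
open import Data.List.Membership.Propositional using (_∈_; _∉_)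
open import Data.Product using (_×_; ∃-syntax)
open import Data.Rational using (_/_; _≤_; +-*-rawSemiring)
open import Algebra.Definitions.RawSemiring +-*-rawSemiring using (_^_)
open import Defs using (NC)

open import Algebra.Bundles using (AbelianGroup)
import Algebra.Properties.AbelianGroup as AbelianGroupProperties
open import Data.Fin.Base as Fin using (Fin; zero; suc; toℕ; fromℕ<; punchIn; punchOut)
open import Data.Fin.Patterns using (0F; 1F; 2F; 3F; 4F)
open import Data.Fin.Permutation
  using (Permutation′; _⟨$⟩ʳ_; _⟨$⟩ˡ_; inverseʳ; inverseˡ; insert; insert-punchIn)
  renaming (id to idₚ)
import Data.Fin.Properties as Fin
import Data.Integer as ℤ
import Data.Integer.Properties as ℤ
open import Data.List as List using (allFin; cartesianProductWith; _++_)
open import Data.List.Membership.Propositional using (find; lose)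
open import Data.List.Membership.Propositional.Properties
  using (∈-allFin; ∈-lookup; ∈-map⁺; ∈-map⁻; ∈-++⁺ˡ; ∈-++⁺ʳ; ∈-++⁻;
         ∈-cartesianProductWith⁺; ∈-cartesianProductWith⁻)
import Data.List.Relation.Unary.All as All
open import Data.List.Relation.Unary.Any as Any using (Any)
import Data.List.Relation.Unary.Any.Properties as Any
open import Data.Nat as ℕ using (zero; suc; _∸_; _!; NonZero)
  renaming (_^_ to infixr 8 _^ℕ_; _≤_ to infix 4 _≤ℕ_; _<_ to infix 4 _<ℕ_)
open import Data.Nat.DivMod
  using (_mod_; m%n<n; m<n⇒m%n≡m; [m+kn]%n≡m%n; %-distribˡ-+; m≡m%n+[m/n]*n; m<n*o⇒m/o<n)
  renaming (_/_ to infixl 7 _/ℕ_)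
import Data.Nat.Properties as ℕ
open import Data.Nat.Solver using (module +-*-Solver)
open import Data.Product using (∃!; _,_; proj₁; proj₂; swap)
open import Data.Rational using (ℚ; NonNegative; toℚᵘ)
import Data.Rational.Base as ℚ
import Data.Rational.Properties as ℚ
open import Data.Rational.Unnormalised using (mkℚᵘ; _≃_; *≤*)
import Data.Rational.Unnormalised.Base as ℚᵘ
import Data.Rational.Unnormalised.Properties as ℚᵘ
open import Data.Sum as Sum using (_⊎_; inj₁; inj₂)
open import Data.Sum.Properties using (inj₁-injective; inj₂-injective)
open import Data.Vec.Base as Vec using (Vec; []; _∷_)
open import Data.Vec.Membership.Propositional using () renaming (_∈_ to infix 4 _∈ᵛ_)
import Data.Vec.Membership.Propositional.Properties as ∈ᵛ
import Data.Vec.Properties as Vec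
open import Data.Vec.Relation.Unary.All using ([]; _∷_)
open import Data.Vec.Relation.Unary.AllPairs using ([]; _∷_; allPairs?)
open import Data.Vec.Relation.Unary.Any as VecAny using (here; there)
import Data.Vec.Relation.Unary.Any.Properties as VecAny
open import Data.Vec.Relation.Unary.Unique.Propositional using (Unique)
import Data.Vec.Relation.Unary.Unique.Propositional.Properties as Unique
open import Defs
  using (Blocks; edges; Joins; joins?; joins⇔; Joins-map⁺; Joins-map⁻; IsCycle;
         SameCycle; sameCycle?; map-resp-≈; ≈-refl; ≈-sym; ≈-trans; _⊕_; translate;
         IsDesign; IsCyclic; IsCyclicDesign; Isomorphic;
         representatives; representatives-cyclic; representatives-complete)
  renaming (_∈_ to infix 4 _∈≈_)
open import Function.Base using (_∘_)
open import Function.Bundles using (Equivalence)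
open import Function.Definitions using (Injective)
open import Level using (0ℓ)
open import Relation.Binary.PropositionalEquality hiding ([_])
open import Relation.Nullary
open import Relation.Nullary.Decidable using (from-yes)

open Equivalence using (to)

-- Powers of rationals bounded by powers of natural numbers.

toℚᵘ-/1 : ∀ a → toℚᵘ (+ a / 1) ≃ mkℚᵘ (+ a) 0
toℚᵘ-/1 a = ℚ.toℚᵘ-fromℚᵘ (mkℚᵘ (+ a) 0)

*-/1 : ∀ a b → (+ a / 1) ℚ.* (+ b / 1) ≡ + (a * b) / 1
*-/1 a b = ℚ.toℚᵘ-injective (begin-equality
  toℚᵘ ((+ a / 1) ℚ.* (+ b / 1))         ≃⟨ ℚ.toℚᵘ-homo-* (+ a / 1) (+ b / 1) ⟩
  toℚᵘ (+ a / 1) ℚᵘ.* toℚᵘ (+ b / 1)     ≃⟨ ℚᵘ.*-cong (toℚᵘ-/1 a) (toℚᵘ-/1 b) ⟩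
  mkℚᵘ (+ a ℤ.* + b) 0                   ≡⟨ cong (λ i → mkℚᵘ i 0) (ℤ.pos-* a b) ⟨
  mkℚᵘ (+ (a * b)) 0                     ≃⟨ toℚᵘ-/1 (a * b) ⟨
  toℚᵘ (+ (a * b) / 1)                   ∎)
  where open ℚᵘ.≤-Reasoning

/1-mono-≤ : ∀ {a b} → a ≤ℕ b → + a / 1 ≤ + b / 1
/1-mono-≤ {a} {b} a≤b = ℚ.toℚᵘ-cancel-≤ (begin
  toℚᵘ (+ a / 1)  ≃⟨ toℚᵘ-/1 a ⟩
  mkℚᵘ (+ a) 0    ≤⟨ *≤* (ℤ.*-monoʳ-≤-nonNeg (+ 1) (ℤ.+≤+ a≤b)) ⟩
  mkℚᵘ (+ b) 0    ≃⟨ toℚᵘ-/1 b ⟨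
  toℚᵘ (+ b / 1)  ∎)
  where open ℚᵘ.≤-Reasoning

^-≤-/1 : ∀ (p : ℚ) .{{_ : NonNegative p}} {k} → p ≤ + k / 1 → ∀ n → p ^ n ≤ + (k ^ℕ n) / 1
^-≤-/1 p         p≤k zero    = ℚ.≤-refl
^-≤-/1 p {k = k} p≤k (suc n) = begin
  p ℚ.* p ^ n                     ≤⟨ ℚ.*-monoˡ-≤-nonNeg p (^-≤-/1 p p≤k n) ⟩
  p ℚ.* (+ (k ^ℕ n) / 1)          ≤⟨ ℚ.*-monoʳ-≤-nonNeg (+ (k ^ℕ n) / 1) p≤k ⟩
  (+ k / 1) ℚ.* (+ (k ^ℕ n) / 1)  ≡⟨ *-/1 k (k ^ℕ n) ⟩
  + (k ^ℕ suc n) / 1              ∎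
  where
  open ℚ.≤-Reasoning
  instance _ = ℚ.normalize-nonNeg (k ^ℕ n) 1

-- Growth of the factorial.

-- Each of the top `k` factors of `(k + M) !` is at least `suc M`.
^≤! : ∀ M k → suc M ^ℕ k ≤ℕ (k + M) !
^≤! M zero    = ℕ.1≤n! M
^≤! M (suc k) = ℕ.*-mono-≤ (ℕ.s≤s (ℕ.m≤n+m M k)) (^≤! M k)

n≤2^n : ∀ n → n ≤ℕ 2 ^ℕ n
n≤2^n zero    = ℕ.z≤n
n≤2^n (suc n) = ℕ.≤-trans (ℕ.+-mono-≤ (ℕ.m^n>0 2 n) (n≤2^n n))
  (ℕ.≤-reflexive (cong (λ m → 2 ^ℕ n + m) (sym (ℕ.+-identityʳ (2 ^ℕ n)))))

^-distribʳ-* : ∀ a b n → (a * b) ^ℕ n ≡ a ^ℕ n * b ^ℕ n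
^-distribʳ-* a b zero    = refl
^-distribʳ-* a b (suc n) = trans (cong (λ m → a * b * m) (^-distribʳ-* a b n))
  (ℕ.[m*n]*[o*p]≡[m*o]*[n*p] a b (a ^ℕ n) (b ^ℕ n))

-- Put M = 2 K and n = k + M. Then n! ≥ (M + 1)ᵏ ≥ 2ᵏ Kᵏ, and the threshold forces k ≥ C Kᴹ, so that
-- 2ᵏ ≥ k absorbs both the constant and the missing factors Kᴹ.
exponential≤factorial : ∀ C K → ∃[ N ] ∀ n → n ≥ N → C * K ^ℕ n ≤ℕ n !
exponential≤factorial C K = C * K ^ℕ M + M , λ n n≥N →
  let M≤n : M ≤ℕ n
      M≤n = ℕ.≤-trans (ℕ.m≤n+m M (C * K ^ℕ M)) n≥N
  in subst (λ m → C * K ^ℕ m ≤ℕ m !) (ℕ.m∸n+n≡m M≤n)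
       (bound (n ∸ M) (ℕ.m+n≤o⇒m≤o∸n (C * K ^ℕ M) n≥N))
  where
  open ℕ.≤-Reasoning
  open +-*-Solver

  M = 2 * K

  bound : ∀ k → C * K ^ℕ M ≤ℕ k → C * K ^ℕ (k + M) ≤ℕ (k + M) !
  bound k le = begin
    C * K ^ℕ (k + M)            ≡⟨ cong (C *_) (ℕ.^-distribˡ-+-* K k M) ⟩
    C * (K ^ℕ k * K ^ℕ M)       ≡⟨ solve 3 (λ c a b → c :* (a :* b) := c :* b :* a) refl
                                     C (K ^ℕ k) (K ^ℕ M) ⟩
    C * K ^ℕ M * K ^ℕ k         ≤⟨ ℕ.*-monoˡ-≤ (K ^ℕ k) (ℕ.≤-trans le (n≤2^n k)) ⟩
    2 ^ℕ k * K ^ℕ k             ≡⟨ ^-distribʳ-* 2 K k ⟨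
    M ^ℕ k                      ≤⟨ ℕ.^-monoˡ-≤ k (ℕ.n≤1+n M) ⟩
    suc M ^ℕ k                  ≤⟨ ^≤! M k ⟩
    (k + M) !                   ∎

-- Since 10 n + 5 ≤ 15 · 2ⁿ, the polynomial factor is at most 15ᵉ (2ᵉ)ⁿ, which only enlarges the
-- constant and the base of the exponential.
exponential*polynomial≤factorial :
  ∀ K e → ∃[ N ] ∀ n → n ≥ N → K ^ℕ n * (10 * n + 5) ^ℕ e ≤ℕ n !
exponential*polynomial≤factorial K e =
  let N , bound = exponential≤factorial (15 ^ℕ e) (K * 2 ^ℕ e) in N , λ n n≥N → (begin
    K ^ℕ n * (10 * n + 5) ^ℕ e          ≤⟨ ℕ.*-monoʳ-≤ (K ^ℕ n) (ℕ.^-monoˡ-≤ e (linear n)) ⟩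
    K ^ℕ n * (15 * 2 ^ℕ n) ^ℕ e         ≡⟨ cong (λ m → K ^ℕ n * m) (^-distribʳ-* 15 (2 ^ℕ n) e) ⟩
    K ^ℕ n * (15 ^ℕ e * (2 ^ℕ n) ^ℕ e)  ≡⟨ cong (λ m → K ^ℕ n * (15 ^ℕ e * m)) (swap-exponents n) ⟩
    K ^ℕ n * (15 ^ℕ e * (2 ^ℕ e) ^ℕ n)  ≡⟨ solve 3 (λ a b c → a :* (b :* c) := b :* (a :* c)) refl
                                             (K ^ℕ n) (15 ^ℕ e) ((2 ^ℕ e) ^ℕ n) ⟩
    15 ^ℕ e * (K ^ℕ n * (2 ^ℕ e) ^ℕ n)  ≡⟨ cong (λ m → 15 ^ℕ e * m) (^-distribʳ-* K (2 ^ℕ e) n) ⟨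
    15 ^ℕ e * (K * 2 ^ℕ e) ^ℕ n         ≤⟨ bound n n≥N ⟩
    n !                                 ∎)
  where
  open ℕ.≤-Reasoning
  open +-*-Solver

  linear : ∀ n → 10 * n + 5 ≤ℕ 15 * 2 ^ℕ n
  linear n = ℕ.≤-trans
    (ℕ.+-mono-≤ (ℕ.*-monoʳ-≤ 10 (n≤2^n n)) (ℕ.*-monoʳ-≤ 5 (ℕ.m^n>0 2 n)))
    (ℕ.≤-reflexive (sym (ℕ.*-distribʳ-+ (2 ^ℕ n) 10 5)))

  swap-exponents : ∀ n → (2 ^ℕ n) ^ℕ e ≡ (2 ^ℕ e) ^ℕ n
  swap-exponents n = trans (ℕ.^-*-assoc 2 n e)
    (trans (cong (2 ^ℕ_) (ℕ.*-comm n e)) (sym (ℕ.^-*-assoc 2 e n)))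

-- Enumeration of permutations.

-- Factorial number system: the leading digit of `k` is the image of `zero`, and the remaining
-- digits enumerate what the permutation does to the other points.
nthPermutation : ∀ n → Fin (n !) → Permutation′ n
nthPermutation zero    _ = idₚ
nthPermutation (suc n) k =
  insert zero (Fin.quotient {suc n} (n !) k) (nthPermutation n (Fin.remainder {suc n} (n !) k))

nthPermutation-injective : ∀ {n} {k l : Fin (n !)} →
  (∀ i → nthPermutation n k ⟨$⟩ʳ i ≡ nthPermutation n l ⟨$⟩ʳ i) → k ≡ l
nthPermutation-injective {zero} {zero} {zero} _ = refl
nthPermutation-injective {suc n} {k} {l} eq = begin
  k                  ≡⟨ Fin.combine-remQuot {suc n} (n !) k ⟨
  Fin.combine q r    ≡⟨ cong₂ Fin.combine q≡q′ (nthPermutation-injective {n} tail) ⟩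
  Fin.combine q′ r′  ≡⟨ Fin.combine-remQuot {suc n} (n !) l ⟩
  l                  ∎
  where
  open ≡-Reasoning
  q  = Fin.quotient {suc n} (n !) k
  q′ = Fin.quotient {suc n} (n !) l
  r  = Fin.remainder {suc n} (n !) k
  r′ = Fin.remainder {suc n} (n !) l

  q≡q′ : q ≡ q′
  q≡q′ = eq zero

  tail : ∀ i → nthPermutation n r ⟨$⟩ʳ i ≡ nthPermutation n r′ ⟨$⟩ʳ i
  tail i = Fin.punchIn-injective q′ _ _ (begin
    punchIn q′ (nthPermutation n r ⟨$⟩ʳ i)   ≡⟨ cong (λ j → punchIn j πᵢ) q≡q′ ⟨
    punchIn q (nthPermutation n r ⟨$⟩ʳ i)    ≡⟨ insert-punchIn zero q (nthPermutation n r) i ⟨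
    nthPermutation (suc n) k ⟨$⟩ʳ suc i      ≡⟨ eq (suc i) ⟩
    nthPermutation (suc n) l ⟨$⟩ʳ suc i      ≡⟨ insert-punchIn zero q′ (nthPermutation n r′) i ⟩
    punchIn q′ (nthPermutation n r′ ⟨$⟩ʳ i)  ∎)
    where πᵢ = nthPermutation n r ⟨$⟩ʳ i

-- The group of residues modulo `v`.

module Residues (v : ℕ) .{{_ : NonZero v}} where

  [_] : ℕ → Fin v
  [ k ] = k mod v

  toℕ-[] : ∀ k → toℕ [ k ] ≡ k % v
  toℕ-[] k = Fin.toℕ-fromℕ< (m%n<n k v)

  []-toℕ : ∀ x → [ toℕ x ] ≡ x
  []-toℕ x = Fin.toℕ-injective (trans (toℕ-[] (toℕ x)) (m<n⇒m%n≡m (Fin.toℕ<n x)))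

  []-cong-% : ∀ {a b} → a % v ≡ b % v → [ a ] ≡ [ b ]
  []-cong-% {a} {b} eq = Fin.toℕ-injective (trans (toℕ-[] a) (trans eq (sym (toℕ-[] b))))

  []-+* : ∀ a k → [ a + k * v ] ≡ [ a ]
  []-+* a k = []-cong-% ([m+kn]%n≡m%n a k v)

  []-injective : ∀ {a b} → a <ℕ v → b <ℕ v → [ a ] ≡ [ b ] → a ≡ b
  []-injective {a} {b} a<v b<v eq = begin
    a         ≡⟨ m<n⇒m%n≡m a<v ⟨
    a % v     ≡⟨ toℕ-[] a ⟨
    toℕ [ a ] ≡⟨ cong toℕ eq ⟩
    toℕ [ b ] ≡⟨ toℕ-[] b ⟩
    b % v     ≡⟨ m<n⇒m%n≡m b<v ⟩
    b         ∎
    where open ≡-Reasoning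

  []-⊕ : ∀ a b → [ a ] ⊕ [ b ] ≡ [ a + b ]
  []-⊕ a b = []-cong-% (begin
    (toℕ [ a ] + toℕ [ b ]) % v  ≡⟨ cong₂ (λ i j → (i + j) % v) (toℕ-[] a) (toℕ-[] b) ⟩
    (a % v + b % v) % v          ≡⟨ %-distribˡ-+ a b v ⟨
    (a + b) % v                  ∎)
    where open ≡-Reasoning

  private
    infix 8 ⊝_
    ⊝_ : Fin v → Fin v
    ⊝ x = [ v ∸ toℕ x ]

  ⊕-comm : ∀ x y → x ⊕ y ≡ y ⊕ x
  ⊕-comm x y = cong [_] (ℕ.+-comm (toℕ x) (toℕ y))

  ⊕-assoc : ∀ x y z → (x ⊕ y) ⊕ z ≡ x ⊕ (y ⊕ z)
  ⊕-assoc x y z = begin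
    (x ⊕ y) ⊕ z                              ≡⟨ cong ((x ⊕ y) ⊕_) ([]-toℕ z) ⟨
    [ toℕ x + toℕ y ] ⊕ [ toℕ z ]            ≡⟨ []-⊕ _ (toℕ z) ⟩
    [ toℕ x + toℕ y + toℕ z ]                ≡⟨ cong [_] (ℕ.+-assoc (toℕ x) (toℕ y) (toℕ z)) ⟩
    [ toℕ x + (toℕ y + toℕ z) ]              ≡⟨ []-⊕ (toℕ x) _ ⟨
    [ toℕ x ] ⊕ (y ⊕ z)                      ≡⟨ cong (_⊕ (y ⊕ z)) ([]-toℕ x) ⟩
    x ⊕ (y ⊕ z)                              ∎
    where open ≡-Reasoning

  ⊕-identityˡ : ∀ x → [ 0 ] ⊕ x ≡ x
  ⊕-identityˡ x = begin
    [ 0 ] ⊕ x             ≡⟨ cong ([ 0 ] ⊕_) ([]-toℕ x) ⟨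
    [ 0 ] ⊕ [ toℕ x ]     ≡⟨ []-⊕ 0 (toℕ x) ⟩
    [ toℕ x ]             ≡⟨ []-toℕ x ⟩
    x                     ∎
    where open ≡-Reasoning

  ⊕-inverseˡ : ∀ x → ⊝ x ⊕ x ≡ [ 0 ]
  ⊕-inverseˡ x = begin
    ⊝ x ⊕ x                  ≡⟨ cong (⊝ x ⊕_) ([]-toℕ x) ⟨
    ⊝ x ⊕ [ toℕ x ]          ≡⟨ []-⊕ (v ∸ toℕ x) (toℕ x) ⟩
    [ v ∸ toℕ x + toℕ x ]    ≡⟨ cong [_] (ℕ.m∸n+n≡m (ℕ.<⇒≤ (Fin.toℕ<n x))) ⟩
    [ v ]                    ≡⟨ cong [_] (ℕ.*-identityˡ v) ⟨
    [ 0 + 1 * v ]            ≡⟨ []-+* 0 1 ⟩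
    [ 0 ]                    ∎
    where open ≡-Reasoning

  ⊕-identityʳ : ∀ x → x ⊕ [ 0 ] ≡ x
  ⊕-identityʳ x = trans (⊕-comm x [ 0 ]) (⊕-identityˡ x)

  ⊕-abelianGroup : AbelianGroup 0ℓ 0ℓ
  ⊕-abelianGroup = record
    { _≈_ = _≡_
    ; _∙_ = _⊕_
    ; ε = [ 0 ]
    ; _⁻¹ = ⊝_
    ; isAbelianGroup = record
      { isGroup = record
        { isMonoid = record
          { isSemigroup = record
            { isMagma = isMagma _⊕_
            ; assoc = ⊕-assoc
            }
          ; identity = ⊕-identityˡ , ⊕-identityʳ
          }
        ; inverse = ⊕-inverseˡ , λ x → trans (⊕-comm x (⊝ x)) (⊕-inverseˡ x)
        ; ⁻¹-cong = cong ⊝_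
        }
      ; comm = ⊕-comm
      }
    }

  ⊕-cancelˡ : ∀ z x y → z ⊕ x ≡ z ⊕ y → x ≡ y
  ⊕-cancelˡ = AbelianGroupProperties.∙-cancelˡ ⊕-abelianGroup

  ⊕-cancelʳ : ∀ z x y → x ⊕ z ≡ y ⊕ z → x ≡ y
  ⊕-cancelʳ = AbelianGroupProperties.∙-cancelʳ ⊕-abelianGroup

  infixl 6 _⊖_

  abstract
    _⊖_ : Fin v → Fin v → Fin v
    y ⊖ x = y ⊕ ⊝ x

    x⊕[y⊖x]≡y : ∀ x y → x ⊕ (y ⊖ x) ≡ y
    x⊕[y⊖x]≡y x y = trans (⊕-comm x (y ⊖ x))
      (AbelianGroupProperties.//-rightDividesˡ ⊕-abelianGroup x y)

    ⊖-unique : ∀ {x y d} → x ⊕ d ≡ y → y ⊖ x ≡ d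
    ⊖-unique {x} {y} {d} refl = trans (cong (_⊖ x) (⊕-comm x d))
      (AbelianGroupProperties.//-rightDividesʳ ⊕-abelianGroup x d)

  ⊖-translate : ∀ x y z → (y ⊕ z) ⊖ (x ⊕ z) ≡ y ⊖ x
  ⊖-translate x y z = ⊖-unique (begin
    (x ⊕ z) ⊕ (y ⊖ x)  ≡⟨ cong (_⊕ (y ⊖ x)) (⊕-comm x z) ⟩
    (z ⊕ x) ⊕ (y ⊖ x)  ≡⟨ ⊕-assoc z x (y ⊖ x) ⟩
    z ⊕ (x ⊕ (y ⊖ x))  ≡⟨ cong (z ⊕_) (x⊕[y⊖x]≡y x y) ⟩
    z ⊕ y              ≡⟨ ⊕-comm z y ⟩
    y ⊕ z              ∎)
    where open ≡-Reasoning

  -- Developments of base cycles and difference families.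

  shift : ∀ {k} → Fin v → Vec (Fin v) k → Vec (Fin v) k
  shift z = Vec.map (_⊕ z)

  shift-shift : ∀ {k} z z′ (c : Vec (Fin v) k) → shift z′ (shift z c) ≡ shift (z ⊕ z′) c
  shift-shift z z′ c = trans (sym (Vec.map-∘ (_⊕ z′) (_⊕ z) c))
    (Vec.map-cong (λ x → ⊕-assoc x z z′) c)

  -- A base cycle fixed by some translations is listed several times; this is harmless because
  -- `Blocks` are read as sets.
  development : ∀ {k} → Blocks v k → Blocks v k
  development F = cartesianProductWith shift (allFin v) F

  module _ {k} {F : Blocks v k} where

    ∈-development⁺ : ∀ {b c} z → b ∈ F → SameCycle c (shift z b) → c ∈≈ development F
    ∈-development⁺ z b∈F = lose (∈-cartesianProductWith⁺ shift (∈-allFin z) b∈F)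

    ∈-development⁻ : ∀ {c} → c ∈≈ development F → ∃[ z ] ∃[ b ] b ∈ F × SameCycle c (shift z b)
    ∈-development⁻ c∈ with d , d∈ , c≈d ← find c∈
      with z , b , _ , b∈F , refl ← ∈-cartesianProductWith⁻ shift (allFin v) F d∈
      = z , b , b∈F , c≈d

    development-cyclic : IsCyclic (development F)
    development-cyclic = idₚ , λ z c∈ →
      let d , d∈ , c≈d = find c∈
          e , e∈ , d≡ = ∈-map⁻ (Vec.map (translate idₚ z)) d∈
          z′ , b , _ , b∈F , e≡ = ∈-cartesianProductWith⁻ shift (allFin v) F e∈
      in ∈-development⁺ (z′ ⊕ z) b∈F
           (subst (SameCycle _)
             (trans d≡ (trans (cong (shift z) e≡) (shift-shift z′ z b))) c≈d)

    -- Existence: a base edge p q with difference y - x is carried onto x y by the translation by x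
    -- - p. Uniqueness: any cycle of the development through x y comes from a base edge with that
    -- same difference, moved to the same starting point. Its conclusion is `SameCycle` rather than
    -- equality of shifts and base cycles, which admits base cycles with short orbits.
    development-design : 3 ≤ℕ k →
      (∀ {b} → b ∈ F → Unique b) →
      (∀ d → d ≢ [ 0 ] → ∃[ b ] ∃[ p ] ∃[ q ] b ∈ F × Joins b p q × q ⊖ p ≡ d) →
      (∀ {b b′ p p′ q q′} z z′ → b ∈ F → b′ ∈ F → Joins b p q → Joins b′ p′ q′ →
        q ⊖ p ≡ q′ ⊖ p′ → p ⊕ z ≡ p′ ⊕ z′ → SameCycle (shift z b) (shift z′ b′)) →
      IsDesign (development F)
    development-design 3≤k unique cover same = All.tabulate cycles , partition
      where
      cycles : ∀ {c} → c ∈ development F → IsCycle c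
      cycles c∈ with z , b , _ , b∈F , refl ← ∈-cartesianProductWith⁻ shift (allFin v) F c∈ =
        3≤k , Unique.map⁺ (λ {x} {y} → ⊕-cancelʳ z x y) (unique b∈F)

      partition : ∀ x y → x ≢ y → ∃! SameCycle λ c → c ∈≈ development F × Joins c x y
      partition x y x≢y
        with b , p , q , b∈F , j , q⊖p ← cover (y ⊖ x) (λ y⊖x≡0 → x≢y
          (trans (sym (⊕-identityʳ x)) (trans (cong (x ⊕_) (sym y⊖x≡0)) (x⊕[y⊖x]≡y x y))))
        = shift z b
        , ( ∈-development⁺ z b∈F ≈-refl
          , subst₂ (Joins (shift z b)) (x⊕[y⊖x]≡y p x) q⊕z≡y (Joins-map⁺ (_⊕ z) b j))
        , λ (d∈ , jd) →
            let z′ , b′ , b′∈F , d≈ = ∈-development⁻ d∈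
                p′ , q′ , p′z , q′z , j′ = Joins-map⁻ (_⊕ z′) b′ (to (joins⇔ d≈ x y) jd)
            in ≈-trans (same z z′ b∈F b′∈F j j′
                 (trans q⊖p (trans (sym (cong₂ _⊖_ q′z p′z)) (⊖-translate p′ q′ z′)))
                 (trans (x⊕[y⊖x]≡y p x) (sym p′z))) (≈-sym d≈)
        where
        open ≡-Reasoning
        z = x ⊖ p
        q⊕z≡y : q ⊕ z ≡ y
        q⊕z≡y = begin
          q ⊕ z                ≡⟨ cong (_⊕ z) (x⊕[y⊖x]≡y p q) ⟨
          (p ⊕ (q ⊖ p)) ⊕ z    ≡⟨ cong (_⊕ z) (⊕-comm p (q ⊖ p)) ⟩
          ((q ⊖ p) ⊕ p) ⊕ z    ≡⟨ ⊕-assoc (q ⊖ p) p z ⟩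
          (q ⊖ p) ⊕ (p ⊕ z)    ≡⟨ cong₂ _⊕_ q⊖p (x⊕[y⊖x]≡y p x) ⟩
          (y ⊖ x) ⊕ x          ≡⟨ ⊕-comm (y ⊖ x) x ⟩
          x ⊕ (y ⊖ x)          ≡⟨ x⊕[y⊖x]≡y x y ⟩
          y                    ∎

-- Surjections between finite sets of equal size.

-- The section `g` is injective. If it missed a point, punching that point out would inject
-- `Fin (suc m)` into `Fin m`; so `g` is onto and is a two-sided inverse of `f`.
section⇒injective : ∀ {m k} → m ≡ k → (f : Fin m → Fin k) (g : Fin k → Fin m) →
                    (∀ y → f (g y) ≡ y) → Injective _≡_ _≡_ f
section⇒injective {zero} refl f g fg {()}
section⇒injective {suc m} refl f g fg {x} {y} fx≡fy =
  trans (sym (gf x)) (trans (cong g fx≡fy) (gf y))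
  where
  g-injective : Injective _≡_ _≡_ g
  g-injective {a} {b} ga≡gb = trans (sym (fg a)) (trans (cong f ga≡gb) (fg b))

  gf : ∀ x → g (f x) ≡ x
  gf x with Fin.any? (λ y → g y Fin.≟ x)
  ... | yes (y , gy≡x) = trans (cong (g ∘ f) (sym gy≡x)) (trans (cong g (fg y)) gy≡x)
  ... | no  x∉g = contradiction
    (Fin.injective⇒≤ {f = λ y → punchOut (x≢g y)}
      (λ {a} {b} eq → g-injective (Fin.punchOut-injective (x≢g a) (x≢g b) eq)))
    ℕ.1+n≰n
    where
    x≢g : ∀ y → x ≢ g y
    x≢g y x≡gy = x∉g (y , sym x≡gy)

-- Adjacency in terms of positions, and rigidity of 5-cycles.

Joins-sym : ∀ {v k} (c : Vec (Fin v) k) {x y} → Joins c x y → Joins c y x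
Joins-sym c = Sum.swap

-- A cycle is the image of `Vec.allFin k` under its own lookup, which is injective here. Adjacency
-- of vertices thus becomes adjacency of positions, which can be decided on `Fin 5` once and for
-- all.
Joins-lookup⁻ : ∀ {v k} {c : Vec (Fin v) k} → Unique c → ∀ i {u} → Joins c (Vec.lookup c i) u →
                ∃[ j ] u ≡ Vec.lookup c j × Joins (Vec.allFin k) i j
Joins-lookup⁻ {c = c} unique i {u} p
  with a , j , eq , eq′ , q ← Joins-map⁻ (Vec.lookup c) (Vec.allFin _)
         (subst (λ d → Joins d (Vec.lookup c i) u) (sym (Vec.map-lookup-allFin c)) p)
  with refl ← Unique.lookup-injective unique a i eq
  = j , sym eq′ , q

Joins-lookup⁺ : ∀ {v k} (c : Vec (Fin v) k) {i j} → Joins (Vec.allFin k) i j →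
                Joins c (Vec.lookup c i) (Vec.lookup c j)
Joins-lookup⁺ c {i} {j} q = subst (λ d → Joins d (Vec.lookup c i) (Vec.lookup c j))
  (Vec.map-lookup-allFin c) (Joins-map⁺ (Vec.lookup c) (Vec.allFin _) q)

-- `SameCycle` leaves rotation and reversal free; agreement at two adjacent positions fixes both. In
-- the full cycles below, position 2 holds y + w, which carries the permutation, and position 4
-- holds 2 y.
module _ {v} {c d : Vec (Fin v) 5} (c! : Unique c) (d! : Unique d) (c≈d : SameCycle c d)
         (eq₀ : Vec.lookup c 0F ≡ Vec.lookup d 0F) (eq₁ : Vec.lookup c 1F ≡ Vec.lookup d 1F) where

  private
    -- If b and j are the only neighbours of a, and c and d agree at a and b, they agree at j.
    second-neighbour : ∀ a b j →
      (∀ k → Joins (Vec.allFin 5) a k → k ≡ b ⊎ k ≡ j) → Joins (Vec.allFin 5) a j → b ≢ j →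
      Vec.lookup c a ≡ Vec.lookup d a → Vec.lookup c b ≡ Vec.lookup d b →
      Vec.lookup c j ≡ Vec.lookup d j
    second-neighbour a b j neighbours q b≢j eqa eqb
      with k , eq , r ← Joins-lookup⁻ d! a (to (joins⇔ c≈d _ _)
             (subst (λ x → Joins c x (Vec.lookup c j)) eqa (Joins-lookup⁺ c q)))
      with neighbours k r
    ... | inj₁ refl = contradiction (Unique.lookup-injective c! b j (trans eqb (sym eq))) b≢j
    ... | inj₂ refl = eq

    neighbours? : ∀ a b j → Dec (∀ k → Joins (Vec.allFin 5) a k → k ≡ b ⊎ k ≡ j)
    neighbours? a b j = Fin.all? λ k →
      joins? (Vec.allFin 5) a k →-dec ((k Fin.≟ b) ⊎-dec (k Fin.≟ j))

  SameCycle-lookup₂ : Vec.lookup c 2F ≡ Vec.lookup d 2F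
  SameCycle-lookup₂ = second-neighbour 1F 0F 2F
    (from-yes (neighbours? 1F 0F 2F)) (from-yes (joins? (Vec.allFin 5) 1F 2F)) (λ ()) eq₁ eq₀

  SameCycle-lookup₄ : Vec.lookup c 4F ≡ Vec.lookup d 4F
  SameCycle-lookup₄ = second-neighbour 0F 1F 4F
    (from-yes (neighbours? 0F 1F 4F)) (from-yes (joins? (Vec.allFin 5) 0F 4F)) (λ ()) eq₀ eq₁

-- The pentagon and the pentagram in ℤ/5.

turn : ∀ {w} → Fin w → Fin w → Vec (Fin w) 5
turn x s = Vec.iterate (_⊕ s) x 5

-- The steps of the two short cycles in units of h: 1 for the pentagon and 2 for the pentagram.
-- `negative` lists the opposite steps 4 = -1 and 3 = -2.
stride : Fin 2 → Fin 5
stride 0F = 1F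
stride 1F = 2F

negative : Fin 2 → Fin 5
negative 0F = 4F
negative 1F = 3F

stride-negative : ∀ t → stride t ⊕ negative t ≡ 0F
stride-negative 0F = refl
stride-negative 1F = refl

stride-injective : ∀ {t u} → stride t ≡ stride u → t ≡ u
stride-injective {0F} {0F} _ = refl
stride-injective {0F} {1F} ()
stride-injective {1F} {0F} ()
stride-injective {1F} {1F} _ = refl

negative-injective : ∀ {t u} → negative t ≡ negative u → t ≡ u
negative-injective {0F} {0F} _ = refl
negative-injective {0F} {1F} ()
negative-injective {1F} {0F} ()
negative-injective {1F} {1F} _ = refl

stride≢negative : ∀ t u → stride t ≢ negative u
stride≢negative 0F 0F ()
stride≢negative 0F 1F ()
stride≢negative 1F 0F ()
stride≢negative 1F 1F ()

pentagon : Fin 2 → Vec (Fin 5) 5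
pentagon t = turn 0F (stride t)

pentagon-unique : ∀ t → Unique (pentagon t)
pentagon-unique = from-yes (Fin.all? λ t → allPairs? (λ x y → ¬? (x Fin.≟ y)) (pentagon t))

-- Checked by exhaustion. Every edge is a step of the stride in one of its directions, and
-- rotational symmetry lets the cycle be restarted at the tail of that step.
pentagon-joins : ∀ t p q → Joins (pentagon t) p q →
  (p ⊕ stride t ≡ q × SameCycle (pentagon t) (turn p (stride t))) ⊎
  (q ⊕ stride t ≡ p × SameCycle (pentagon t) (turn q (stride t)))
pentagon-joins = from-yes (Fin.all? λ t → Fin.all? λ p → Fin.all? λ q →
  joins? (pentagon t) p q →-dec
   ((((p ⊕ stride t) Fin.≟ q) ×-dec sameCycle? (pentagon t) (turn p (stride t))) ⊎-dec
   (((q ⊕ stride t) Fin.≟ p) ×-dec sameCycle? (pentagon t) (turn q (stride t)))))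

-- Isomorphisms, uniqueness of blocks, and encoding of functions.

Isomorphic-image : ∀ {v k} {B R : Blocks v k} (α : Isomorphic B R) {c : Vec (Fin v) k} →
                   c ∈ B → Vec.map (Isomorphic.π α ⟨$⟩ʳ_) c ∈≈ R
Isomorphic-image α c∈B = proj₁ (Isomorphic.image≐ α) (Any.map (λ { refl → ≈-refl }) (∈-map⁺ _ c∈B))

IsDesign-unique : ∀ {v k} {R : Blocks v k} → IsDesign R → ∀ {c d x y} → x ≢ y →
                  c ∈≈ R → d ∈≈ R → Joins c x y → Joins d x y → SameCycle c d
IsDesign-unique (_ , part) x≢y c∈R d∈R cxy dxy =
  let _ , _ , u = part _ _ x≢y in ≈-trans (≈-sym (u (c∈R , cxy))) (u (d∈R , dxy))

⟨$⟩ʳ-injective : ∀ {n} (π : Permutation′ n) → Injective _≡_ _≡_ (π ⟨$⟩ʳ_)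
⟨$⟩ʳ-injective π eq = trans (sym (inverseˡ π)) (trans (cong (π ⟨$⟩ˡ_) eq) (inverseˡ π))

funToFin-injective : ∀ {a b} {f g : Fin a → Fin b} → Fin.funToFin f ≡ Fin.funToFin g → f ≗ g
funToFin-injective {f = f} {g} eq x = begin
  f x                           ≡⟨ Fin.finToFun-funToFin f x ⟨
  Fin.finToFun (Fin.funToFin f) x  ≡⟨ cong (λ k → Fin.finToFun k x) eq ⟩
  Fin.finToFun (Fin.funToFin g) x  ≡⟨ Fin.finToFun-funToFin g x ⟩
  g x                           ∎
  where open ≡-Reasoning

-- Splitting and reflecting ranges of residues.

-- Here `r` stands for the residue r + 1 in 1 ... 2n: the first case gives the values x in 1 ... n,
-- the second the values w in n + 1 ... 2n.
HalfOf : ℕ → ℕ → Set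
HalfOf n r = (∃[ i ] toℕ {n} i ≡ r) ⊎ (∃[ j ] n + toℕ {n} j ≡ r)

halfOf : ∀ n {r} → r <ℕ n + n → HalfOf n r
halfOf n {r} r<n+n with r ℕ.<? n
... | yes r<n = inj₁ (fromℕ< r<n , Fin.toℕ-fromℕ< r<n)
... | no  r≮n with j , refl ← ℕ.m≤n⇒∃[o]m+o≡n (ℕ.≮⇒≥ r≮n) =
  inj₂ (fromℕ< j<n , cong (λ k → n + k) (Fin.toℕ-fromℕ< j<n))
  where
  j<n = ℕ.+-cancelˡ-< n j n r<n+n

half : ∀ r → (∃[ k ] k + k ≡ r) ⊎ (∃[ k ] suc (k + k) ≡ r)
half zero = inj₁ (0 , refl)
half (suc r) with half r
... | inj₁ (k , refl) = inj₂ (k , refl)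
... | inj₂ (k , refl) = inj₁ (suc k , cong suc (ℕ.+-suc k k))

+-cancel-double-< : ∀ {k n} → k + k <ℕ n + n → k <ℕ n
+-cancel-double-< lt = ℕ.≰⇒> λ n≤k → ℕ.<⇒≱ lt (ℕ.+-mono-≤ n≤k n≤k)

-- In the offset form where `r` stands for r + 1, this is reflection s ↦ m + 1 - s of 1 ... m; for m
-- = 2n it is s ↦ h - s.
complement : ∀ {m r} → r <ℕ m → ∃[ r′ ] r + suc r′ ≡ m × r′ <ℕ m
complement {m} {r} r<m with r′ , refl ← ℕ.m≤n⇒∃[o]m+o≡n r<m =
  r′ , ℕ.+-suc r r′ , ℕ.s≤s (ℕ.m≤n+m r′ r)

-- The multiples of h and the short base cycles.

module Construction (n v : ℕ) .{{_ : NonZero v}} (v≡10n+5 : v ≡ 10 * n + 5) where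

  h : ℕ
  h = suc (n + n)

  v≡5h : v ≡ 5 * h
  v≡5h = trans v≡10n+5 (solve 1 (λ n → con 10 :* n :+ con 5 := con 5 :* (con 1 :+ (n :+ n))) refl n)
    where open +-*-Solver

  open Residues v

  -- A copy of ℤ/5 in ℤ/v, as the subgroup generated by h; it respects addition because v = 5 h.
  mult : Fin 5 → Fin v
  mult m = [ toℕ m * h ]

  [*h]≡mult : ∀ m → [ m * h ] ≡ mult (m mod 5)
  [*h]≡mult m = begin
    [ m * h ]                          ≡⟨ cong (λ k → [ k * h ]) (m≡m%n+[m/n]*n m 5) ⟩
    [ (m % 5 + m /ℕ 5 * 5) * h ]       ≡⟨ cong [_] (expand (m % 5) (m /ℕ 5) h) ⟩
    [ m % 5 * h + m /ℕ 5 * (5 * h) ]   ≡⟨ cong (λ w → [ m % 5 * h + m /ℕ 5 * w ]) v≡5h ⟨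
    [ m % 5 * h + m /ℕ 5 * v ]         ≡⟨ []-+* (m % 5 * h) (m /ℕ 5) ⟩
    [ m % 5 * h ]                      ≡⟨ cong (λ k → [ k * h ]) (Fin.toℕ-fromℕ< (m%n<n m 5)) ⟨
    mult (m mod 5)                     ∎
    where
    open ≡-Reasoning
    open +-*-Solver
    expand : ∀ r q h → (r + q * 5) * h ≡ r * h + q * (5 * h)
    expand = solve 3 (λ r q h → (r :+ q :* con 5) :* h := r :* h :+ q :* (con 5 :* h)) refl

  mult-⊕ : ∀ a b → mult (a ⊕ b) ≡ mult a ⊕ mult b
  mult-⊕ a b = sym (begin
    mult a ⊕ mult b              ≡⟨ []-⊕ (toℕ a * h) (toℕ b * h) ⟩
    [ toℕ a * h + toℕ b * h ]    ≡⟨ cong [_] (ℕ.*-distribʳ-+ h (toℕ a) (toℕ b)) ⟨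
    [ (toℕ a + toℕ b) * h ]      ≡⟨ [*h]≡mult (toℕ a + toℕ b) ⟩
    mult (a ⊕ b)                 ∎)
    where open ≡-Reasoning

  mult-turn : ∀ x s → Vec.map mult (turn x s) ≡ turn (mult x) (mult s)
  mult-turn x s = iterate 5 x
    where
    iterate : ∀ k x → Vec.map mult (Vec.iterate (_⊕ s) x k) ≡ Vec.iterate (_⊕ mult s) (mult x) k
    iterate zero    x = refl
    iterate (suc k) x = cong (mult x ∷_) (trans (iterate k (x ⊕ s))
      (cong (λ y → Vec.iterate (_⊕ mult s) y k) (mult-⊕ x s)))

  shift-turn : ∀ x s z → shift z (turn x s) ≡ turn (x ⊕ z) s
  shift-turn x s z = iterate 5 x
    where
    iterate : ∀ k x → Vec.map (_⊕ z) (Vec.iterate (_⊕ s) x k) ≡ Vec.iterate (_⊕ s) (x ⊕ z) k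
    iterate zero    x = refl
    iterate (suc k) x = cong ((x ⊕ z) ∷_) (trans (iterate k (x ⊕ s))
      (cong (λ y → Vec.iterate (_⊕ s) y k)
        (trans (⊕-assoc x s z) (trans (cong (x ⊕_) (⊕-comm s z)) (sym (⊕-assoc x z s))))))

  short : Fin 2 → Vec (Fin v) 5
  short t = Vec.map mult (pentagon t)

  -- The full base cycles and the differences they cover.

  small : Fin n → ℕ
  small i = suc (toℕ i)

  module _ (π : Permutation′ n) where

    large : Fin n → ℕ
    large i = suc (n + toℕ (π ⟨$⟩ʳ i))

    -- The chain 0 < x < y < y + w < 2 y < v of integers makes the five vertices distinct residues.
    module Vertices (i : Fin n) where

      x y w : ℕ
      x = small i
      y = h + x
      w = large i

      x>0 : 0 <ℕ x
      x>0 = ℕ.s≤s ℕ.z≤n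

      x<y : x <ℕ y
      x<y = ℕ.m<n+m x (ℕ.s≤s ℕ.z≤n)

      y<y+w : y <ℕ y + w
      y<y+w = ℕ.m<m+n y (ℕ.s≤s ℕ.z≤n)

      y+w<2y : y + w <ℕ y + y
      y+w<2y = ℕ.+-monoʳ-< y
        (ℕ.<-≤-trans (ℕ.s≤s (ℕ.+-monoʳ-< n (Fin.toℕ<n (π ⟨$⟩ʳ i)))) (ℕ.m≤m+n h x))

      2y<v : y + y <ℕ v
      2y<v = begin-strict
        y + y                  <⟨ ℕ.+-mono-< y<2h y<2h ⟩
        h + h + (h + h)        ≤⟨ ℕ.m≤n+m _ h ⟩
        h + (h + h + (h + h))  ≡⟨ solve 1 (λ h → h :+ (h :+ h :+ (h :+ h)) := con 5 :* h) refl h ⟩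
        5 * h                  ≡⟨ v≡5h ⟨
        v                      ∎
        where
        open ℕ.≤-Reasoning
        open +-*-Solver
        y<2h : y <ℕ h + h
        y<2h = ℕ.+-monoʳ-< h (ℕ.s≤s (ℕ.<-≤-trans (Fin.toℕ<n i) (ℕ.m≤m+n n n)))

      y+w<v : y + w <ℕ v
      y+w<v = ℕ.<-trans y+w<2y 2y<v

    full : Fin n → Vec (Fin v) 5
    full i = Vec.map [_] (0 ∷ x ∷ y + w ∷ y ∷ y + y ∷ [])
      where open Vertices i

    Full : Fin v → Set
    Full d = ∃[ i ] ∃[ p ] ∃[ q ] Joins (full i) p q × p ⊕ d ≡ q

    -- The same edge read backwards.
    Full-opposite : ∀ a b → a + b ≡ v → Full [ a ] → Full [ b ]
    Full-opposite a b a+b≡v (i , p , q , j , refl) = i , q , p , Joins-sym (full i) j , (begin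
      (p ⊕ [ a ]) ⊕ [ b ]   ≡⟨ ⊕-assoc p [ a ] [ b ] ⟩
      p ⊕ ([ a ] ⊕ [ b ])   ≡⟨ cong (p ⊕_) ([]-⊕ a b) ⟩
      p ⊕ [ a + b ]         ≡⟨ cong (λ k → p ⊕ [ k ]) (trans a+b≡v (sym (ℕ.*-identityˡ v))) ⟩
      p ⊕ [ 0 + 1 * v ]     ≡⟨ cong (p ⊕_) ([]-+* 0 1) ⟩
      p ⊕ [ 0 ]             ≡⟨ ⊕-identityʳ p ⟩
      p                     ∎)
      where open ≡-Reasoning

    -- Differences below 2 h come in pairs r, h + r: x with y = h + x, and w with h + w.
    LowFull : ℕ → Set
    LowFull r = Full [ r ] × Full [ h + r ]

    low-small : ∀ i → LowFull (small i)
    low-small i =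
      (i , [ 0 ] , [ x ] , inj₁ (here refl) , []-⊕ 0 x) ,
      (i , [ y ] , [ y + y ] , inj₁ (there (there (there (here refl)))) , []-⊕ y y)
      where open Vertices i

    low-large : ∀ i → LowFull (large i)
    low-large i =
      (i , [ y ] , [ y + w ] , inj₂ (there (there (here refl))) , []-⊕ y w) ,
      (i , [ x ] , [ y + w ] , inj₁ (there (here refl)) , trans ([]-⊕ x (h + w)) (cong [_]
        (solve 3 (λ x h w → x :+ (h :+ w) := h :+ x :+ w) refl x h w)))
      where
      open +-*-Solver
      open Vertices i

    low : ∀ {r} → HalfOf n r → LowFull (suc r)
    low (inj₁ (i , refl)) = low-small i
    low (inj₂ (j , refl)) =
      subst (λ k → LowFull (suc (n + toℕ k))) (inverseʳ π) (low-large (π ⟨$⟩ˡ j))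

    double : ∀ i → Full [ h + small i + (h + small i) ]
    double i =
      i , [ 0 ] , [ y + y ] , inj₂ (there (there (there (there (here refl))))) , []-⊕ 0 (y + y)
      where open Vertices i

    -- Write s = r + 1, so 0 < s < h. Blocks 0 and 1 are the low differences, and blocks 4 and 3 are
    -- their negatives. In the middle block, 2 h + s is 2 y with x = s / 2 when s is even. When s is
    -- odd, h - s is even because h is odd, and -(2 h + s) = 2 h + (h - s) reduces to the even case.
    nonmultiple : ∀ (q : Fin 5) {r} → r <ℕ n + n → Full [ suc r + toℕ q * h ]
    nonmultiple 0F {r} lt = subst (λ k → Full [ k ])
      (sym (ℕ.+-identityʳ (suc r))) (proj₁ (low (halfOf n lt)))
    nonmultiple 1F {r} lt = subst (λ k → Full [ k ])
      (solve 2 (λ h x → h :+ x := x :+ (h :+ con 0)) refl h (suc r)) (proj₂ (low (halfOf n lt)))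
      where open +-*-Solver
    nonmultiple 2F {r} lt = even-odd (half r) lt
      where
      open +-*-Solver
      double′ : ∀ {k} → k <ℕ n → Full [ h + suc k + (h + suc k) ]
      double′ k<n = subst (λ m → Full [ h + suc m + (h + suc m) ])
        (Fin.toℕ-fromℕ< k<n) (double (fromℕ< k<n))

      even-odd : ∀ {r} → (∃[ k ] k + k ≡ r) ⊎ (∃[ k ] suc (k + k) ≡ r) → r <ℕ n + n →
                 Full [ suc r + 2 * h ]
      even-odd (inj₁ (k , refl)) lt =
        let m , k+m≡n , m<n = complement {r = k} (+-cancel-double-< lt) in
        Full-opposite (h + suc m + (h + suc m)) (suc (k + k) + 2 * h) (trans
          (solve 3 (λ h k m → h :+ m :+ (h :+ m) :+ (con 1 :+ (k :+ k) :+ con 2 :* h) :=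
                              con 1 :+ ((k :+ m) :+ (k :+ m)) :+ con 4 :* h) refl h k (suc m))
          (trans (cong (λ l → suc (l + l) + 4 * h) k+m≡n) (sym v≡5h)))
          (double′ m<n)
      even-odd (inj₂ (k , refl)) lt = subst (λ l → Full [ l ])
        (solve 2 (λ h k → h :+ (con 1 :+ k) :+ (h :+ (con 1 :+ k)) :=
                          con 2 :+ (k :+ k) :+ con 2 :* h) refl h k)
        (double′ (+-cancel-double-< (ℕ.<-trans (ℕ.n<1+n _) lt)))
    nonmultiple 3F {r} lt =
      let m , r+m≡2n , m<2n = complement lt in
      Full-opposite (h + suc m) (suc r + 3 * h) (trans
        (solve 3 (λ h r m → h :+ m :+ (con 1 :+ r :+ con 3 :* h) :=
                            con 1 :+ (r :+ m) :+ con 4 :* h) refl h r (suc m))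
        (trans (cong (λ l → suc l + 4 * h) r+m≡2n) (sym v≡5h)))
        (proj₂ (low (halfOf n m<2n)))
      where open +-*-Solver
    nonmultiple 4F {r} lt =
      let m , r+m≡2n , m<2n = complement lt in
      Full-opposite (suc m) (suc r + 4 * h) (trans
        (solve 3 (λ h r m → m :+ (con 1 :+ r :+ con 4 :* h) :=
                            con 1 :+ (r :+ m) :+ con 4 :* h) refl h r (suc m))
        (trans (cong (λ l → suc l + 4 * h) r+m≡2n) (sym v≡5h)))
        (proj₁ (low (halfOf n m<2n)))
      where open +-*-Solver

    cover : ∀ d → Full d ⊎ (∃[ m ] mult m ≡ d)
    cover d = subst (λ e → Full e ⊎ (∃[ m ] mult m ≡ e))
      (trans (cong [_] (sym (m≡m%n+[m/n]*n (toℕ d) h))) ([]-toℕ d))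
      (split (toℕ d % h) (toℕ d /ℕ h) (m%n<n (toℕ d) h)
        (m<n*o⇒m/o<n (subst (λ k → toℕ d <ℕ k) v≡5h (Fin.toℕ<n d))))
      where
      split : ∀ r q → r <ℕ h → q <ℕ 5 → Full [ r + q * h ] ⊎ (∃[ m ] mult m ≡ [ r + q * h ])
      split zero    q _            q<5 =
        inj₂ (fromℕ< q<5 , cong (λ k → [ k * h ]) (Fin.toℕ-fromℕ< q<5))
      split (suc r) q (ℕ.s≤s r<2n) q<5 = inj₁ (subst (λ k → Full [ suc r + k * h ])
        (Fin.toℕ-fromℕ< q<5) (nonmultiple (fromℕ< q<5) r<2n))

    -- Each difference occurs only once, by counting.

    arcs : Fin n → Vec (Fin v × Fin v) 10
    arcs i = edges (full i) Vec.++ Vec.map swap (edges (full i))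

    -- A label is a directed edge of a full cycle or a multiple of h.  Counting 0 among the multiples
    -- gives exactly v labels, so that surjectivity of difference implies injectivity.
    difference : Fin 10 × Fin n ⊎ Fin 5 → Fin v
    difference (inj₁ (e , i)) = proj₂ (Vec.lookup (arcs i) e) ⊖ proj₁ (Vec.lookup (arcs i) e)
    difference (inj₂ m)       = mult m

    Joins⇒arc : ∀ i {p q} → Joins (full i) p q → ∃[ e ] Vec.lookup (arcs i) e ≡ (p , q)
    Joins⇒arc i {p} {q} = Sum.[ position ∘ ∈ᵛ.∈-++⁺ˡ
                              , position ∘ ∈ᵛ.∈-++⁺ʳ (edges (full i)) ∘ ∈ᵛ.∈-map⁺ swap ]′
      where
      position : (p , q) ∈ᵛ arcs i → ∃[ e ] Vec.lookup (arcs i) e ≡ (p , q)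
      position p∈ = VecAny.index p∈ , sym (VecAny.lookup-index p∈)

    decode : Fin (10 * n + 5) → Fin 10 × Fin n ⊎ Fin 5
    decode = Sum.map₁ (Fin.remQuot n) ∘ Fin.splitAt (10 * n)

    encode : Fin 10 × Fin n ⊎ Fin 5 → Fin (10 * n + 5)
    encode = Fin.join (10 * n) 5 ∘ Sum.map₁ (λ (e , i) → Fin.combine e i)

    decode-encode : ∀ l → decode (encode l) ≡ l
    decode-encode (inj₁ (e , i)) = trans
      (cong (Sum.map₁ (Fin.remQuot n)) (Fin.splitAt-↑ˡ (10 * n) (Fin.combine e i) 5))
      (cong inj₁ (Fin.remQuot-combine e i))
    decode-encode (inj₂ m)       = cong (Sum.map₁ (Fin.remQuot n)) (Fin.splitAt-↑ʳ (10 * n) 5 m)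

    difference-surjective : ∀ d → ∃[ l ] difference l ≡ d
    difference-surjective d = go (cover d)
      where
      fromFull : Full d → ∃[ l ] difference l ≡ d
      fromFull (i , p , q , j , p⊕d≡q) =
        let e , eq = Joins⇒arc i j in
        inj₁ (e , i) , trans (cong (λ (a , b) → b ⊖ a) eq) (⊖-unique p⊕d≡q)

      go : Full d ⊎ (∃[ m ] mult m ≡ d) → ∃[ l ] difference l ≡ d
      go (inj₁ F)        = fromFull F
      go (inj₂ (m , eq)) = inj₂ m , eq

    -- Via `encode` and `decode` the labels form a set of 10 n + 5 = v elements, so a choice of
    -- label for each difference is a section to which `section⇒injective` applies. Uniqueness of
    -- differences thus follows from coverage.
    difference-injective : ∀ {l l′} → difference l ≡ difference l′ → l ≡ l′
    difference-injective {l} {l′} eq = begin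
      l                   ≡⟨ decode-encode l ⟨
      decode (encode l)   ≡⟨ cong decode encode≡ ⟩
      decode (encode l′)  ≡⟨ decode-encode l′ ⟩
      l′                  ∎
      where
      open ≡-Reasoning

      label : Fin v → Fin 10 × Fin n ⊎ Fin 5
      label = proj₁ ∘ difference-surjective

      difference-decode-encode : ∀ l → difference (decode (encode l)) ≡ difference l
      difference-decode-encode l = cong difference (decode-encode l)

      encode≡ : encode l ≡ encode l′
      encode≡ = section⇒injective (sym v≡10n+5) (difference ∘ decode) (encode ∘ label)
        (λ d → trans (difference-decode-encode (label d)) (proj₂ (difference-surjective d)))
        (trans (difference-decode-encode l) (trans eq (sym (difference-decode-encode l′))))

    full-unique : ∀ i → Unique (full i)
    full-unique i =
      (ne x>0 x<v ∷ ne (ℕ.<-trans y>0 y<y+w) y+w<v ∷ ne y>0 y<v ∷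
       ne (ℕ.<-trans y>0 y<2y) 2y<v ∷ []) ∷
      (ne (ℕ.<-trans x<y y<y+w) y+w<v ∷ ne x<y y<v ∷ ne (ℕ.<-trans x<y y<2y) 2y<v ∷ []) ∷
      (ne y<y+w y+w<v ∘ sym ∷ ne y+w<2y 2y<v ∷ []) ∷
      (ne y<2y 2y<v ∷ []) ∷
      [] ∷ []
      where
      open Vertices i
      y<2y = ℕ.<-trans y<y+w y+w<2y
      y<v  = ℕ.<-trans y<2y 2y<v
      x<v  = ℕ.<-trans x<y y<v
      y>0  = ℕ.<-trans x>0 x<y

      ne : ∀ {a b} → a <ℕ b → b <ℕ v → [ a ] ≢ [ b ]
      ne a<b b<v eq = ℕ.<⇒≢ a<b ([]-injective (ℕ.<-trans a<b b<v) b<v eq)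

    mult-injective : ∀ {a b} → mult a ≡ mult b → a ≡ b
    mult-injective = inj₂-injective ∘ difference-injective

    short-unique : ∀ t → Unique (short t)
    short-unique t = Unique.map⁺ mult-injective (pentagon-unique t)

    -- The base cycles form a difference family.

    family : Blocks v 5
    family = List.map full (allFin n) ++ List.map short (allFin 2)

    family⁻ : ∀ {b} → b ∈ family → (∃[ i ] b ≡ full i) ⊎ (∃[ t ] b ≡ short t)
    family⁻ b∈ = Sum.map
      (λ p → let i , _ , eq = ∈-map⁻ full p in i , eq)
      (λ p → let t , _ , eq = ∈-map⁻ short {xs = allFin 2} p in t , eq)
      (∈-++⁻ (List.map full (allFin n)) b∈)

    full∈family : ∀ i → full i ∈ family
    full∈family i = ∈-++⁺ˡ (∈-map⁺ full (∈-allFin i))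

    short∈family : ∀ t → short t ∈ family
    short∈family t = ∈-++⁺ʳ (List.map full (allFin n)) (∈-map⁺ short (∈-allFin t))

    full-arc : ∀ i {p q} → Joins (full i) p q →
               ∃[ e ] Vec.lookup (arcs i) e ≡ (p , q) × difference (inj₁ (e , i)) ≡ q ⊖ p
    full-arc i j = let e , eq = Joins⇒arc i j in e , eq , cong (λ (a , b) → b ⊖ a) eq

    -- Every translate of the short cycle can be restarted at the image of `p`. This replaces
    -- equality of shifts, which fails for short orbits.
    Turns : Fin 2 → Fin v → Set
    Turns t p = ∀ z → SameCycle (shift z (short t)) (turn (p ⊕ z) (mult (stride t)))

    ShortArc : Fin 2 → Fin v → Fin v → Set
    ShortArc t p q = (q ⊖ p ≡ mult (stride t) × Turns t p) ⊎ (q ⊖ p ≡ mult (negative t) × Turns t q)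

    short-arc : ∀ t {p q} → Joins (short t) p q → ShortArc t p q
    short-arc t {p} {q} j =
      let a , b , a≡p , b≡q , r = Joins-map⁻ mult (pentagon t) j in
      go a b a≡p b≡q (pentagon-joins t a b r)
      where
      moved : ∀ a → SameCycle (pentagon t) (turn a (stride t)) → Turns t (mult a)
      moved a t≈ z = subst (SameCycle (shift z (short t)))
        (trans (cong (shift z) (mult-turn a (stride t))) (shift-turn (mult a) (mult (stride t)) z))
        (map-resp-≈ (_⊕ z) (map-resp-≈ mult t≈))

      back : ∀ b {a} → b ⊕ stride t ≡ a → mult a ⊕ mult (negative t) ≡ mult b
      back b refl = begin
        mult (b ⊕ stride t) ⊕ mult (negative t)         ≡⟨ cong (_⊕ _) (mult-⊕ b (stride t)) ⟩
        (mult b ⊕ mult (stride t)) ⊕ mult (negative t)  ≡⟨ ⊕-assoc (mult b) _ _ ⟩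
        mult b ⊕ (mult (stride t) ⊕ mult (negative t))  ≡⟨ cong (mult b ⊕_) (mult-⊕ (stride t) (negative t)) ⟨
        mult b ⊕ mult (stride t ⊕ negative t)           ≡⟨ cong (mult b ⊕_) (cong mult (stride-negative t)) ⟩
        mult b ⊕ [ 0 ]                                  ≡⟨ ⊕-identityʳ (mult b) ⟩
        mult b                                          ∎
        where open ≡-Reasoning

      go : ∀ a b → mult a ≡ p → mult b ≡ q →
        (a ⊕ stride t ≡ b × SameCycle (pentagon t) (turn a (stride t))) ⊎
        (b ⊕ stride t ≡ a × SameCycle (pentagon t) (turn b (stride t))) →
        ShortArc t p q
      go a b refl refl (inj₁ (eq , t≈)) =
        inj₁ (⊖-unique (trans (sym (mult-⊕ a (stride t))) (cong mult eq)) , moved a t≈)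
      go a b refl refl (inj₂ (eq , t≈)) = inj₂ (⊖-unique (back b eq) , moved b t≈)

    family-cover : ∀ d → d ≢ [ 0 ] → ∃[ b ] ∃[ p ] ∃[ q ] b ∈ family × Joins b p q × q ⊖ p ≡ d
    family-cover d d≢0 = go (cover d)
      where
      forward : ∀ t → Joins (short t) (mult 0F) (mult (stride t))
      forward t = Joins-map⁺ mult (pentagon t) (edge t)
        where
        edge : ∀ t → Joins (pentagon t) 0F (stride t)
        edge 0F = inj₁ (here refl)
        edge 1F = inj₁ (here refl)

      use : ∀ t (m : Fin 5) → ∀ {p q} → Joins (short t) p q → p ⊕ mult m ≡ q → mult m ≡ d →
            ∃[ b ] ∃[ p ] ∃[ q ] b ∈ family × Joins b p q × q ⊖ p ≡ d
      use t m {p} {q} j eq eq′ = short t , p , q , short∈family t , j , trans (⊖-unique eq) eq′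

      opposite : ∀ t → mult (stride t) ⊕ mult (negative t) ≡ mult 0F
      opposite t = trans (sym (mult-⊕ (stride t) (negative t))) (cong mult (stride-negative t))

      multiples : ∀ m → mult m ≡ d → ∃[ b ] ∃[ p ] ∃[ q ] b ∈ family × Joins b p q × q ⊖ p ≡ d
      multiples 0F eq = contradiction (sym eq) d≢0
      multiples 1F eq = use 0F 1F (forward 0F) (⊕-identityˡ _) eq
      multiples 2F eq = use 1F 2F (forward 1F) (⊕-identityˡ _) eq
      multiples 3F eq = use 1F 3F (Joins-sym (short 1F) (forward 1F)) (opposite 1F) eq
      multiples 4F eq = use 0F 4F (Joins-sym (short 0F) (forward 0F)) (opposite 0F) eq

      go : Full d ⊎ (∃[ m ] mult m ≡ d) → ∃[ b ] ∃[ p ] ∃[ q ] b ∈ family × Joins b p q × q ⊖ p ≡ d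
      go (inj₁ (i , p , q , j , eq)) = full i , p , q , full∈family i , j , ⊖-unique eq
      go (inj₂ (m , eq))             = multiples m eq

    -- Equal differences force the same stride and direction, and both cycles are then the turn with
    -- that stride from a common vertex. The turn starts at the image of p or of q according to the
    -- direction, hence the equations at both ends.
    short-same : ∀ t u {p p′ q q′} z z′ → Joins (short t) p q → Joins (short u) p′ q′ →
      q ⊖ p ≡ q′ ⊖ p′ → p ⊕ z ≡ p′ ⊕ z′ → q ⊕ z ≡ q′ ⊕ z′ →
      SameCycle (shift z (short t)) (shift z′ (short u))
    short-same t u z z′ j j′ d≡ pz≡ qz≡ = go (short-arc t j) (short-arc u j′)
      where
      via : ∀ {x y} → SameCycle (shift z (short t)) (turn x (mult (stride t))) → x ≡ y →
            SameCycle (shift z′ (short u)) (turn y (mult (stride u))) → t ≡ u →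
            SameCycle (shift z (short t)) (shift z′ (short u))
      via c≈ refl d≈ refl = ≈-trans c≈ (≈-sym d≈)

      go : _ → _ → _
      go (inj₁ (eq , c≈)) (inj₁ (eq′ , d≈)) =
        via (c≈ z) pz≡ (d≈ z′) (stride-injective (mult-injective (trans (sym eq) (trans d≡ eq′))))
      go (inj₁ (eq , _)) (inj₂ (eq′ , _)) =
        contradiction (mult-injective (trans (sym eq) (trans d≡ eq′))) (stride≢negative t u)
      go (inj₂ (eq , _)) (inj₁ (eq′ , _)) =
        contradiction (mult-injective (trans (sym eq′) (trans (sym d≡) eq))) (stride≢negative u t)
      go (inj₂ (eq , c≈)) (inj₂ (eq′ , d≈)) =
        via (c≈ z) qz≡ (d≈ z′) (negative-injective (mult-injective (trans (sym eq) (trans d≡ eq′))))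

    difference⇒translate : ∀ {p p′ q q′ z z′} → q ⊖ p ≡ q′ ⊖ p′ → p ⊕ z ≡ p′ ⊕ z′ → q ⊕ z ≡ q′ ⊕ z′
    difference⇒translate {p} {p′} {q} {q′} {z} {z′} d≡ pz≡ = begin
      q ⊕ z                                ≡⟨ x⊕[y⊖x]≡y (p ⊕ z) (q ⊕ z) ⟨
      (p ⊕ z) ⊕ ((q ⊕ z) ⊖ (p ⊕ z))        ≡⟨ cong₂ _⊕_ pz≡ (⊖-translate p q z) ⟩
      (p′ ⊕ z′) ⊕ (q ⊖ p)                  ≡⟨ cong ((p′ ⊕ z′) ⊕_) d≡ ⟩
      (p′ ⊕ z′) ⊕ (q′ ⊖ p′)                ≡⟨ cong ((p′ ⊕ z′) ⊕_) (⊖-translate p′ q′ z′) ⟨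
      (p′ ⊕ z′) ⊕ ((q′ ⊕ z′) ⊖ (p′ ⊕ z′))  ≡⟨ x⊕[y⊖x]≡y (p′ ⊕ z′) (q′ ⊕ z′) ⟩
      q′ ⊕ z′                              ∎
      where open ≡-Reasoning

    -- Equal differences have equal labels, so the two base edges coincide; cancelling their
    -- starting point shows that the shifts coincide too.
    full-same : ∀ i i′ {p p′ q q′} z z′ → Joins (full i) p q → Joins (full i′) p′ q′ →
      q ⊖ p ≡ q′ ⊖ p′ → p ⊕ z ≡ p′ ⊕ z′ → SameCycle (shift z (full i)) (shift z′ (full i′))
    full-same i i′ {p} {p′} z z′ j j′ d≡ pz≡ = go (full-arc i j) (full-arc i′ j′)
      where
      go : _ → _ → _
      go (e , at , l) (e′ , at′ , l′) =
        identify (inj₁-injective (difference-injective (trans l (trans d≡ (sym l′)))))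
        where
        identify : (e , i) ≡ (e′ , i′) → SameCycle (shift z (full i)) (shift z′ (full i′))
        identify refl = subst (λ y → SameCycle (shift z (full i)) (shift y (full i)))
          (⊕-cancelˡ p z z′ (trans pz≡ (cong (_⊕ z′) (cong proj₁ (trans (sym at′) at))))) ≈-refl

    full≢short : ∀ i t {p p′ q q′} → Joins (full i) p q → Joins (short t) p′ q′ → q ⊖ p ≢ q′ ⊖ p′
    full≢short i t j j′ d≡ = go (full-arc i j) (short-arc t j′)
      where
      distinct : ∀ e m → difference (inj₁ (e , i)) ≢ difference (inj₂ m)
      distinct e m eq = contradiction (difference-injective {inj₁ (e , i)} {inj₂ m} eq) λ ()

      go : _ → _ → _
      go (e , _ , l) (inj₁ (eq , _)) = distinct e (stride t) (trans l (trans d≡ eq))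
      go (e , _ , l) (inj₂ (eq , _)) = distinct e (negative t) (trans l (trans d≡ eq))

    family-same : ∀ {b b′ p p′ q q′} z z′ → b ∈ family → b′ ∈ family →
      Joins b p q → Joins b′ p′ q′ →
      q ⊖ p ≡ q′ ⊖ p′ → p ⊕ z ≡ p′ ⊕ z′ → SameCycle (shift z b) (shift z′ b′)
    family-same z z′ b∈ b′∈ j j′ d≡ pz≡ = go (family⁻ b∈) (family⁻ b′∈) j j′ d≡
      where
      go : ∀ {b b′} →
        (∃[ i ] b ≡ full i) ⊎ (∃[ t ] b ≡ short t) → (∃[ i ] b′ ≡ full i) ⊎ (∃[ t ] b′ ≡ short t) →
        Joins b _ _ → Joins b′ _ _ → _ → SameCycle (shift z b) (shift z′ b′)
      go (inj₁ (i , refl)) (inj₁ (i′ , refl)) j j′ d≡ = full-same i i′ z z′ j j′ d≡ pz≡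
      go (inj₁ (i , refl)) (inj₂ (t , refl))  j j′ d≡ = contradiction d≡ (full≢short i t j j′)
      go (inj₂ (t , refl)) (inj₁ (i , refl))  j j′ d≡ = contradiction (sym d≡) (full≢short i t j′ j)
      go (inj₂ (t , refl)) (inj₂ (u , refl))  j j′ d≡ =
        short-same t u z z′ j j′ d≡ pz≡ (difference⇒translate d≡ pz≡)

    family-unique : ∀ {b} → b ∈ family → Unique b
    family-unique b∈ = go (family⁻ b∈)
      where
      go : ∀ {b} → (∃[ i ] b ≡ full i) ⊎ (∃[ t ] b ≡ short t) → Unique b
      go (inj₁ (i , refl)) = full-unique i
      go (inj₂ (t , refl)) = short-unique t

    design : Blocks v 5
    design = development family

    design-isCyclicDesign : IsCyclicDesign design
    design-isCyclicDesign =
      development-design (ℕ.s≤s (ℕ.s≤s (ℕ.s≤s ℕ.z≤n))) family-unique family-cover family-same ,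
      development-cyclic

  -- Rigidity of isomorphisms and the count of isomorphism classes.

  module _ (0<n : 0 <ℕ n) where

    i₀ : Fin n
    i₀ = fromℕ< 0<n

    module Determined (π ρ : Permutation′ n) {R : Blocks v 5} (R-design : IsDesign R)
             (α : Isomorphic (design π) R) (β : Isomorphic (design ρ) R) where

      f g : Fin v → Fin v
      f = Isomorphic.π α ⟨$⟩ʳ_
      g = Isomorphic.π β ⟨$⟩ʳ_

      -- The edge 0 x of `full` does not depend on the permutation. If `f` and `g` agree on its
      -- translate by `z`, the two image cycles share an edge of the design `R`, hence are the same
      -- cycle and agree position by position.
      module _ (i : Fin n) (z : Fin v) (eq₀ : f ([ 0 ] ⊕ z) ≡ g ([ 0 ] ⊕ z))
               (eq₁ : f ([ small i ] ⊕ z) ≡ g ([ small i ] ⊕ z)) where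

        private
          c d : Vec (Fin v) 5
          c = Vec.map f (shift z (full π i))
          d = Vec.map g (shift z (full ρ i))

          c! : Unique c
          c! = Unique.map⁺ (⟨$⟩ʳ-injective (Isomorphic.π α))
            (Unique.map⁺ (λ {x} {y} → ⊕-cancelʳ z x y) (full-unique π i))

          d! : Unique d
          d! = Unique.map⁺ (⟨$⟩ʳ-injective (Isomorphic.π β))
            (Unique.map⁺ (λ {x} {y} → ⊕-cancelʳ z x y) (full-unique ρ i))

          c≈d : SameCycle c d
          c≈d = IsDesign-unique R-design
            (λ eq → contradiction (Unique.lookup-injective c! 0F 1F eq) λ ())
            (Isomorphic-image α (shift∈ π)) (Isomorphic-image β (shift∈ ρ))
            (inj₁ (here refl)) (inj₁ (here (cong₂ _,_ eq₀ eq₁)))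
            where
            shift∈ : ∀ π → shift z (full π i) ∈ design π
            shift∈ π = ∈-cartesianProductWith⁺ shift (∈-allFin z) (full∈family π i)

        agree₂ : f ([ h + small i + large π i ] ⊕ z) ≡ g ([ h + small i + large ρ i ] ⊕ z)
        agree₂ = SameCycle-lookup₂ c! d! c≈d eq₀ eq₁

        agree₄ : f ([ h + small i + (h + small i) ] ⊕ z) ≡ g ([ h + small i + (h + small i) ] ⊕ z)
        agree₄ = SameCycle-lookup₄ c! d! c≈d eq₀ eq₁

      -- Agreement is propagated on whole cosets of the multiples of h, because each step from r and
      -- r + 1 to r + 2 overshoots by 2 h.
      Agree : ℕ → Set
      Agree r = ∀ m → f [ r + m * h ] ≡ g [ r + m * h ]

      -- The translate of full i₀ through r and 1 + r contains r + 2 h + 2.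
      agree-step : ∀ r → Agree r → Agree (1 + r) → Agree (2 + r)
      agree-step r agree agree′ m = subst (λ x → f x ≡ g x) last≡
        (agree₄ i₀ z
          (subst (λ x → f x ≡ g x) (sym (⊕-identityˡ z)) (agree (3 + m)))
          (subst (λ x → f x ≡ g x) (sym ([]-⊕ (small i₀) _))
            (subst (λ k → f [ suc k + (r + (3 + m) * h) ] ≡ g [ suc k + (r + (3 + m) * h) ])
              (sym (Fin.toℕ-fromℕ< 0<n)) (agree′ (3 + m)))))
        where
        -- The shift by 3 + m multiples of h compensates the overshoot: 2 h + (3 + m) h = m h + v.
        z : Fin v
        z = [ r + (3 + m) * h ]

        last≡ : [ h + small i₀ + (h + small i₀) ] ⊕ z ≡ [ 2 + r + m * h ]
        last≡ = begin
          [ h + small i₀ + (h + small i₀) ] ⊕ z    ≡⟨ cong (λ k → [ h + suc k + (h + suc k) ] ⊕ z)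
                                                        (Fin.toℕ-fromℕ< 0<n) ⟩
          [ h + 1 + (h + 1) ] ⊕ z                  ≡⟨ []-⊕ _ _ ⟩
          [ h + 1 + (h + 1) + (r + (3 + m) * h) ]  ≡⟨ cong [_] rearrange ⟩
          [ 2 + r + m * h + 1 * (5 * h) ]          ≡⟨ cong (λ w → [ 2 + r + m * h + 1 * w ]) v≡5h ⟨
          [ 2 + r + m * h + 1 * v ]                ≡⟨ []-+* _ 1 ⟩
          [ 2 + r + m * h ]                        ∎
          where
          open ≡-Reasoning
          rearrange : h + 1 + (h + 1) + (r + (3 + m) * h) ≡ 2 + r + m * h + 1 * (5 * h)
          rearrange = solve 3 (λ h r m →
            h :+ con 1 :+ (h :+ con 1) :+ (r :+ (con 3 :+ m) :* h) :=
            con 2 :+ r :+ m :* h :+ con 1 :* (con 5 :* h)) refl h r m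
            where open +-*-Solver

      agree-all : Agree 0 → Agree 1 → ∀ x → f x ≡ g x
      agree-all agree₀ agree₁ x =
        subst (λ x → f x ≡ g x) (trans (cong [_] (ℕ.+-identityʳ (toℕ x))) ([]-toℕ x))
          (proj₁ (go (toℕ x)) 0)
        where
        go : ∀ r → Agree r × Agree (suc r)
        go zero    = agree₀ , agree₁
        go (suc r) = let a , a′ = go r in a′ , agree-step r a a′

      agree-coset : ∀ r → (∀ m → f ([ r ] ⊕ mult m) ≡ g ([ r ] ⊕ mult m)) → Agree r
      agree-coset r eq m = subst (λ x → f x ≡ g x)
        (trans (cong ([ r ] ⊕_) (sym ([*h]≡mult m))) ([]-⊕ r (m * h))) (eq (m mod 5))

      -- Position 2 of the untranslated cycles gives y + w for both permutations. Injectivity of `g`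
      -- and y + w < v turn agreement of the images into equality of integers, and y is common to
      -- both.
      permutations-agree : (∀ x → f x ≡ g x) → ∀ i → π ⟨$⟩ʳ i ≡ ρ ⟨$⟩ʳ i
      permutations-agree f≗g i = Fin.toℕ-injective
        (ℕ.+-cancelˡ-≡ (suc n) _ _ (ℕ.+-cancelˡ-≡ (h + small i) _ _
          ([]-injective (Vertices.y+w<v π i) (Vertices.y+w<v ρ i)
            (⊕-cancelʳ [ 0 ] _ _ (⟨$⟩ʳ-injective (Isomorphic.π β)
              (trans (sym (f≗g _)) (agree₂ i [ 0 ] (f≗g _) (f≗g _))))))))

    -- The values at the ten points of the cosets of 0 and 1, as one number; by `agree-all` they
    -- determine an isomorphism onto a given design.
    cosetCode : (Fin v → Fin v) → Fin (v ^ℕ 5 * v ^ℕ 5)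
    cosetCode f = Fin.combine (Fin.funToFin (λ m → f ([ 0 ] ⊕ mult m)))
                              (Fin.funToFin (λ m → f ([ 1 ] ⊕ mult m)))

    module _ (k : Fin (n !)) where

      found : Any (Isomorphic (design (nthPermutation n k))) (representatives v 5)
      found = representatives-complete (design-isCyclicDesign (nthPermutation n k))

      index : Fin (NC v 5)
      index = Any.index found

      isomorphism :
        Isomorphic (design (nthPermutation n k)) (List.lookup (representatives v 5) index)
      isomorphism = Any.lookup-index found

      code : Fin (NC v 5 * (v ^ℕ 5 * v ^ℕ 5))
      code = Fin.combine index (cosetCode (Isomorphic.π isomorphism ⟨$⟩ʳ_))

    code-injective : ∀ {k l} → code k ≡ code l → k ≡ l
    code-injective {k} {l} eq =
      go (index l) (isomorphism l) (Fin.combine-injective (index k) _ (index l) _ eq)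
      where
      -- The index of the second representative is generalised to `j`, so that matching `refl` gives
      -- both isomorphisms the same target.
      go : ∀ j (β : Isomorphic (design (nthPermutation n l)) (List.lookup (representatives v 5) j)) →
           index k ≡ j ×
           cosetCode (Isomorphic.π (isomorphism k) ⟨$⟩ʳ_) ≡ cosetCode (Isomorphic.π β ⟨$⟩ʳ_) →
           k ≡ l
      go _ β (refl , eq) = nthPermutation-injective {n} (D.permutations-agree (D.agree-all
        (D.agree-coset 0 (funToFin-injective (proj₁ eqs)))
        (D.agree-coset 1 (funToFin-injective (proj₂ eqs)))))
        where
        module D = Determined (nthPermutation n k) (nthPermutation n l)
          (proj₁ (All.lookup (representatives-cyclic v 5) (∈-lookup (index k)))) (isomorphism k) β
        eqs = Fin.combine-injective _ _ _ _ eq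

    n!≤NC*v^10 : n ! ≤ℕ NC v 5 * (v ^ℕ 5 * v ^ℕ 5)
    n!≤NC*v^10 = Fin.injective⇒≤ {f = code} code-injective

-- The lower bound for the number of designs.

10n+5≢0 : ∀ n → NonZero (10 * n + 5)
10n+5≢0 n = ℕ.>-nonZero (ℕ.<-≤-trans (ℕ.s≤s ℕ.z≤n) (ℕ.m≤n+m 5 (10 * n)))

-- The integer 39 exceeds both 38.4 and 29.7, so one bound serves all residues of n modulo 28. The
-- exponent 10 counts the points recorded by `cosetCode`.
39^n≤NC : ∃[ N ] ∀ n → n > 1 → n ≥ N → 39 ^ℕ n ≤ℕ NC (10 * n + 5) 5
39^n≤NC = let N , bound = exponential*polynomial≤factorial 39 10 in N , λ n n>1 n≥N →
  let v = 10 * n + 5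
      instance
        v≢0 = 10n+5≢0 n
        v^10≢0 = ℕ.m^n≢0 v 10
  in ℕ.*-cancelʳ-≤ (39 ^ℕ n) (NC v 5) (v ^ℕ 10) (begin
    39 ^ℕ n * v ^ℕ 10              ≤⟨ bound n n≥N ⟩
    n !                            ≤⟨ Construction.n!≤NC*v^10 n v refl (ℕ.<⇒≤ n>1) ⟩
    NC v 5 * (v ^ℕ 5 * v ^ℕ 5)     ≡⟨ cong (λ m → NC v 5 * m) (ℕ.^-distribˡ-+-* v 5 5) ⟨
    NC v 5 * v ^ℕ 10               ∎)
  where open ℕ.≤-Reasoning

proposition6 : ∃[ N ] ∀ n → n > 1 → n ≥ N →
    (n % 28 ∈ 3 ∷ 5 ∷ 24 ∷ 26 ∷ [] →
    (+ 384 / 10) ^ n ≤ + NC (10 * n + 5) 5 / 1) ×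
    (n % 28 ∉ 3 ∷ 5 ∷ 24 ∷ 26 ∷ [] →
    (+ 297 / 10) ^ n ≤ + NC (10 * n + 5) 5 / 1)
proposition6 = let N , bound = 39^n≤NC in N , λ n n>1 n≥N →
  (λ _ → ℚ.≤-trans (^-≤-/1 (+ 384 / 10) (from-yes (+ 384 / 10 ℚ.≤? + 39 / 1)) n)
                   (/1-mono-≤ (bound n n>1 n≥N))) ,
  (λ _ → ℚ.≤-trans (^-≤-/1 (+ 297 / 10) (from-yes (+ 297 / 10 ℚ.≤? + 39 / 1)) n)
                   (/1-mono-≤ (bound n n>1 n≥N)))
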